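{- Let $q$ be an odd prime power and let $b\in\mathbb{F}_{q^8}^*$ with $b^2=-1$. Then the $\mathbb{F}_q$-subspace $$U_{b,1}=\{(x,bx^q+x^{q^5})\colon x\in\mathbb{F}_{q^8}\}$$ is maximum scattered in $\mathbb{F}_{q^8}\times\mathbb{F}_{q^8}$.
   Context: An $\mathbb{F}_q$-subspace $U$ of $\mathbb{F}_{q^m}\times\mathbb{F}_{q^m}$ is scattered if $\dim_{\mathbb{F}_q}(\langle \mathbf{v}\rangle_{\mathbb{F}_{q^m}}\cap U)\leq 1$ for every nonzero $\mathbf{v}\in\mathbb{F}_{q^m}\times\mathbb{F}_{q^m}$. It is maximum scattered if it is scattered and has the largest possible $\mathbb{F}_q$-dimension among scattered $\mathbb{F}_q$-subspaces of $\mathbb{F}_{q^m}\times\mathbb{F}_{q^m}$; this largest dimension is $m$. -}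

module Defs where

open import Level using (Level; _⊔_; suc)
open import Algebra.Apartness.Bundles using (HeytingField; HeytingCommutativeRing)
open import Algebra.Bundles using (CommutativeRing)
import Algebra.Definitions.RawMonoid as RawMonoidDefinitions
import Algebra.Properties.Semiring.Exp as Exp
open import Algebra.Module.Bundles using (Module)
import Algebra.Module.Construct.DirectProduct as DirectProduct
import Algebra.Module.Construct.TensorUnit as TensorUnit
open import Algebra.Morphism.Bundles using (RingHomomorphism)
open import Data.Fin.Base using (Fin)
open import Data.Nat.Base as ℕ using (ℕ)
open import Data.Nat.Primality using (Prime)
open import Data.Product.Base using (_×_; _,_; ∃; ∃-syntax)
open import Data.Vec.Functional using (Vector)
open import Function.Bundles using (Inverse)
open import Relation.Binary.PropositionalEquality.Core using (_≡_)
open import Relation.Binary.PropositionalEquality.Properties using (setoid)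
open import Relation.Binary.Definitions using (_Respects_)
open import Relation.Unary using (Pred; _∈_; _∩_)

IsPrimePower : ℕ → Set
IsPrimePower q = ∃[ p ] ∃[ k ] Prime p × 1 ℕ.≤ k × q ≡ p ℕ.^ k

-- A field with exactly q elements.  The enumeration makes _≈_ and
-- invertibility decidable, so every x ≉ 0# is invertible: on a finite
-- carrier the Heyting field axioms are the classical field axioms.
record FiniteField (c ℓ a : Level) (q : ℕ) : Set (suc (c ⊔ ℓ ⊔ a)) where
  field
    heytingField : HeytingField c ℓ a

  commutativeRing : CommutativeRing c ℓ
  commutativeRing =
    HeytingCommutativeRing.commutativeRing
      (HeytingField.heytingCommutativeRing heytingField)

  field
    enumeration : Inverse (setoid (Fin q)) (CommutativeRing.setoid commutativeRing)

module _ {r ℓr m ℓm : Level} {R : CommutativeRing r ℓr} (V : Module R m ℓm) where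
  open CommutativeRing R using (Carrier; _≈_; 0#)
  open Module V using (Carrierᴹ; _≈ᴹ_; _+ᴹ_; _*ₗ_; 0ᴹ; +ᴹ-rawMonoid)

  record IsSubspace {p : Level} (U : Pred Carrierᴹ p) : Set (r ⊔ m ⊔ ℓm ⊔ p) where
    field
      respects  : U Respects _≈ᴹ_
      0ᴹ-closed : 0ᴹ ∈ U
      +ᴹ-closed : ∀ {u v} → u ∈ U → v ∈ U → u +ᴹ v ∈ U
      *ₗ-closed : ∀ a {u} → u ∈ U → a *ₗ u ∈ U

  linearCombination : ∀ {n} → Vector Carrier n → Vector Carrierᴹ n → Carrierᴹ
  linearCombination a v = RawMonoidDefinitions.sum +ᴹ-rawMonoid (λ i → a i *ₗ v i)

  LinearlyIndependent : ∀ {n} → Vector Carrierᴹ n → Set (r ⊔ ℓr ⊔ ℓm)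
  LinearlyIndependent v = ∀ a → linearCombination a v ≈ᴹ 0ᴹ → ∀ i → a i ≈ 0#

  record IsBasis {p : Level} (U : Pred Carrierᴹ p) {n : ℕ} (v : Vector Carrierᴹ n)
                 : Set (r ⊔ ℓr ⊔ m ⊔ ℓm ⊔ p) where
    field
      members     : ∀ i → v i ∈ U
      independent : LinearlyIndependent v
      spanning    : ∀ {u} → u ∈ U → ∃[ a ] u ≈ᴹ linearCombination a v

  HasDimension : ∀ {p} → Pred Carrierᴹ p → ℕ → Set (r ⊔ ℓr ⊔ m ⊔ ℓm ⊔ p)
  HasDimension U n = ∃ λ (v : Vector Carrierᴹ n) → IsBasis U v

  ⟨_⟩ : Carrierᴹ → Pred Carrierᴹ (r ⊔ ℓm)
  ⟨ v ⟩ w = ∃[ a ] w ≈ᴹ a *ₗ v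

restrictScalars : ∀ {r ℓr s ℓs m ℓm}
  {R : CommutativeRing r ℓr} {S : CommutativeRing s ℓs} →
  RingHomomorphism (CommutativeRing.rawRing R) (CommutativeRing.rawRing S) →
  Module S m ℓm → Module R m ℓm
restrictScalars {S = S} φ M = record
  { Carrierᴹ = M.Carrierᴹ
  ; _≈ᴹ_     = M._≈ᴹ_
  ; _+ᴹ_     = M._+ᴹ_
  ; _*ₗ_     = λ a x → φ.⟦ a ⟧ M.*ₗ x
  ; _*ᵣ_     = λ x a → x M.*ᵣ φ.⟦ a ⟧
  ; 0ᴹ       = M.0ᴹ
  ; -ᴹ_      = M.-ᴹ_
  ; isModule = record
    { isBimodule = record
      { isBisemimodule = record
        { +ᴹ-isCommutativeMonoid = M.+ᴹ-isCommutativeMonoid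
        ; isPreleftSemimodule = record
          { *ₗ-cong      = λ a≈b → M.*ₗ-cong (φ.⟦⟧-cong a≈b)
          ; *ₗ-zeroˡ     = λ x → M.≈ᴹ-trans (M.*ₗ-congʳ φ.0#-homo) (M.*ₗ-zeroˡ x)
          ; *ₗ-distribʳ  = λ x a b →
              M.≈ᴹ-trans (M.*ₗ-congʳ (φ.+-homo a b)) (M.*ₗ-distribʳ x φ.⟦ a ⟧ φ.⟦ b ⟧)
          ; *ₗ-identityˡ = λ x → M.≈ᴹ-trans (M.*ₗ-congʳ φ.1#-homo) (M.*ₗ-identityˡ x)
          ; *ₗ-assoc     = λ a b x →
              M.≈ᴹ-trans (M.*ₗ-congʳ (φ.*-homo a b)) (M.*ₗ-assoc φ.⟦ a ⟧ φ.⟦ b ⟧ x)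
          ; *ₗ-zeroʳ     = λ a → M.*ₗ-zeroʳ φ.⟦ a ⟧
          ; *ₗ-distribˡ  = λ a → M.*ₗ-distribˡ φ.⟦ a ⟧
          }
        ; isPrerightSemimodule = record
          { *ᵣ-cong      = λ x≈y a≈b → M.*ᵣ-cong x≈y (φ.⟦⟧-cong a≈b)
          ; *ᵣ-zeroʳ     = λ x → M.≈ᴹ-trans (M.*ᵣ-congˡ φ.0#-homo) (M.*ᵣ-zeroʳ x)
          ; *ᵣ-distribˡ  = λ x a b →
              M.≈ᴹ-trans (M.*ᵣ-congˡ (φ.+-homo a b)) (M.*ᵣ-distribˡ x φ.⟦ a ⟧ φ.⟦ b ⟧)
          ; *ᵣ-identityʳ = λ x → M.≈ᴹ-trans (M.*ᵣ-congˡ φ.1#-homo) (M.*ᵣ-identityʳ x)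
          ; *ᵣ-assoc     = λ x a b →
              M.≈ᴹ-trans (M.*ᵣ-assoc x φ.⟦ a ⟧ φ.⟦ b ⟧)
                         (M.*ᵣ-congˡ (S.sym (φ.*-homo a b)))
          ; *ᵣ-zeroˡ     = λ a → M.*ᵣ-zeroˡ φ.⟦ a ⟧
          ; *ᵣ-distribʳ  = λ a → M.*ᵣ-distribʳ φ.⟦ a ⟧
          }
        ; *ₗ-*ᵣ-assoc = λ a x b → M.*ₗ-*ᵣ-assoc φ.⟦ a ⟧ x φ.⟦ b ⟧
        }
      ; -ᴹ‿cong    = M.-ᴹ‿cong
      ; -ᴹ‿inverse = M.-ᴹ‿inverse
      }
    ; *ₗ-*ᵣ-coincident = λ a → M.*ₗ-*ᵣ-coincident φ.⟦ a ⟧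
    }
  }
  where
  module φ = RingHomomorphism φ
  module M = Module M
  module S = CommutativeRing S

-- K = F_q and L = F_{q^m}; the inclusion F_q ⊆ F_{q^m} is a ring
-- homomorphism, automatically injective because K is a field.
module FieldExtension
  {c₁ ℓ₁ a₁ c₂ ℓ₂ a₂ : Level} (q m : ℕ)
  (K : FiniteField c₁ ℓ₁ a₁ q) (L : FiniteField c₂ ℓ₂ a₂ (q ℕ.^ m))
  (φ : RingHomomorphism
         (CommutativeRing.rawRing (FiniteField.commutativeRing K))
         (CommutativeRing.rawRing (FiniteField.commutativeRing L)))
  where

  open CommutativeRing (FiniteField.commutativeRing L) public
    using (Carrier; _≈_; _≉_; _+_; _*_; -_; 0#; 1#; semiring)
  open Exp semiring public using (_^_)

  L² : Module (FiniteField.commutativeRing L) c₂ ℓ₂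
  L² = DirectProduct.⟨module⟩ TensorUnit.⟨module⟩ TensorUnit.⟨module⟩

  L²∣K : Module (FiniteField.commutativeRing K) c₂ ℓ₂
  L²∣K = restrictScalars φ L²

  open Module L² public using (Carrierᴹ; _≈ᴹ_; _≉ᴹ_; 0ᴹ)

  -- Subspaces and dimensions are over K, whereas ⟨ v ⟩ is the L-span.
  record IsScattered {p : Level} (U : Pred Carrierᴹ p)
                     : Set (c₁ ⊔ ℓ₁ ⊔ c₂ ⊔ ℓ₂ ⊔ p) where
    field
      isSubspace : IsSubspace L²∣K U
      dim≤1      : ∀ v → v ≉ᴹ 0ᴹ →
                   ∃[ d ] HasDimension L²∣K (⟨_⟩ L² v ∩ U) d × d ℕ.≤ 1

  -- w is the universe level of the subspaces that U competes with.
  record IsMaximumScattered {p : Level} (w : Level) (U : Pred Carrierᴹ p)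
                            : Set (c₁ ⊔ ℓ₁ ⊔ c₂ ⊔ ℓ₂ ⊔ p ⊔ suc w) where
    field
      isScattered  : IsScattered U
      dim          : ℕ
      hasDimension : HasDimension L²∣K U dim
      maximum      : ∀ (W : Pred Carrierᴹ w) → IsScattered W →
                     ∀ d → HasDimension L²∣K W d → d ℕ.≤ dim

module _ {c₁ ℓ₁ a₁ c₂ ℓ₂ a₂ : Level} (q : ℕ)
  (K : FiniteField c₁ ℓ₁ a₁ q) (L : FiniteField c₂ ℓ₂ a₂ (q ℕ.^ 8))
  (φ : RingHomomorphism
         (CommutativeRing.rawRing (FiniteField.commutativeRing K))
         (CommutativeRing.rawRing (FiniteField.commutativeRing L)))
  where
  open FieldExtension q 8 K L φ

  U[_,1] : Carrier → Pred Carrierᴹ (c₂ ⊔ ℓ₂)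
  U[ b ,1] y = ∃[ x ] y ≈ᴹ (x , b * x ^ q + x ^ (q ℕ.^ 5))

{-# OPTIONS --safe #-}
-- Write f(x) = b x^q + x^(q^5), σ(x) = x^q and λᵢ = σⁱ(λ).  If x ≠ 0 and f(λx) = λ f(x), then
-- b σ(x) (λ₁ − λ₀) = σ⁵(x) (λ₀ − λ₅).  Multiplying by the σ⁴-conjugate of this relation eliminates x;
-- since b² = −1 and σ⁴(b) = b, what remains is
--     2 (P₀ + P₁) = A₀ A₁,   where Aᵢ = λᵢ + λᵢ₊₄ and Pᵢ = λᵢ λᵢ₊₄.
-- The alternating sum of its conjugates is (A₀ − A₂)(A₁ − A₃) = 0, whence A₀ = A₂ and then P₀ = P₂, so
-- {λ₀, λ₄} = {λ₂, λ₆}.  Thus λ₀ = λ₂ = λ₄, the relation becomes 2 (λ₀ − λ₁)² = 0, and λ lies in F_q.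
-- Maximality is a pigeonhole argument: a scattered subspace of dimension > 8 would contain q⁸ + 2
-- pairwise non-proportional vectors, but there are only q⁸ + 1 lines.
module Submission where

open import Defs
open import Level using (Level)
open import Algebra.Apartness.Bundles using (HeytingField)
import Algebra.Apartness.Properties.HeytingCommutativeRing as Heyting
open import Algebra.Bundles using (CommutativeMonoid; CommutativeRing)
open import Algebra.Module.Bundles using (Module)
open import Algebra.Morphism.Bundles using (RingHomomorphism)
import Algebra.Properties.AbelianGroup as AbelianGroupProperties
import Algebra.Properties.CommutativeMonoid.Sum as Sum
import Algebra.Properties.CommutativeSemiring.Binomial as Binomial
import Algebra.Properties.CommutativeSemiring.Exp as Exp
import Algebra.Properties.Ring as RingProperties
import Algebra.Properties.Semiring.Mult as Mult
import Algebra.Solver.Ring.NaturalCoefficients.Default as Solver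
open import Data.Bool.Base using (if_then_else_)
open import Data.Fin.Base as Fin using (Fin; zero; suc; inject₁)
open import Data.Fin.Permutation using (permutation)
import Data.Fin.Properties as Fin
open import Data.Nat.Base as ℕ using (ℕ; zero; suc)
open import Data.Nat.Combinatorics using (_C_; nC1≡n; nCn≡1; nCk+nC[k+1]≡[n+1]C[k+1])
open import Data.Nat.Divisibility using (_∣_; _∤_; divides; ∣⇒≤; m∣m*n; m%n≡0⇒n∣m)
open import Data.Nat.DivMod using (m≡m%n+[m/n]*n; m%n<n)
open import Data.Nat.Primality using (Prime; euclidsLemma; prime⇒nonTrivial)
import Data.Nat.Properties as ℕ
open import Data.Nat.Tactic.RingSolver using (solve-∀)
open import Data.Product.Base using (_×_; _,_; ∃; ∃-syntax; proj₁; proj₂)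
open import Data.Sum.Base using (_⊎_; inj₁; inj₂; [_,_]′; reduce)
open import Data.Vec.Base as Vec using (Vec; []; _∷_)
open import Data.Vec.Functional as Vector using (Vector)
open import Function.Base using (_∘_; id)
open import Function.Bundles using (Inverse)
open import Relation.Binary.Definitions using (_Respects_)
open import Relation.Binary.PropositionalEquality as ≡ using (_≡_; _≢_)
open import Relation.Nullary using (¬_; Dec; yes; no; contradiction)
open import Relation.Nullary.Decidable using (map′; decidable-stable; _×-dec_; ¬?; does; dec-true; dec-false)
open import Relation.Unary using (Pred; _∈_; _∩_)

-- Two vectors (x, f(x)) and (y, f(y)) of `U` with x ≠ 0 lie on one line exactly when y = λx and
-- f(λx) = λ f(x) for some λ; hence scatteredness is the claim that every such λ is in F_q. The
-- exponents 1 and 5 differ by 4, half of 8, so σ⁴ interchanges σ(x) and σ⁵(x). The relation and its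
-- σ⁴-conjugate are therefore two linear relations between the same two nonzero quantities, which is
-- why x drops out. The coefficient b survives conjugation because σ(b) is again a square root of
-- -1: σ(b) = ±b, so already σ²(b) = b. The passage from σ(λ) = λ to λ ∈ F_q is a root count: the q
-- elements of the subfield exhaust the roots of X^q - X. Dimensions must be witnessed by explicit
-- bases. Everything is finite and equality is decidable, so bases are found by exhaustive search,
-- and dimensions are compared through the cardinalities q^n.

-- Divisibility of binomial coefficients by a prime.

[k+1]*[n+1]C[k+1]≡[n+1]*nCk : ∀ n k → suc k ℕ.* (suc n C suc k) ≡ suc n ℕ.* (n C k)
[k+1]*[n+1]C[k+1]≡[n+1]*nCk n zero = begin
  1 ℕ.* (suc n C 1) ≡⟨ ℕ.*-identityˡ _ ⟩
  suc n C 1         ≡⟨ nC1≡n (suc n) ⟩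
  suc n             ≡⟨ ℕ.*-identityʳ (suc n) ⟨
  suc n ℕ.* 1       ∎
  where open ≡.≡-Reasoning
[k+1]*[n+1]C[k+1]≡[n+1]*nCk zero (suc k) = ℕ.*-zeroʳ (suc (suc k))
[k+1]*[n+1]C[k+1]≡[n+1]*nCk (suc m) (suc k) = begin
  2+k ℕ.* (suc (suc m) C 2+k)             ≡⟨ ≡.cong (2+k ℕ.*_) (nCk+nC[k+1]≡[n+1]C[k+1] (suc m) (suc k)) ⟨
  2+k ℕ.* (A ℕ.+ B)                       ≡⟨ regroup k A B ⟩
  suc k ℕ.* A ℕ.+ 2+k ℕ.* B ℕ.+ A         ≡⟨ ≡.cong (ℕ._+ A) (≡.cong₂ ℕ._+_ ([k+1]*[n+1]C[k+1]≡[n+1]*nCk m k) ([k+1]*[n+1]C[k+1]≡[n+1]*nCk m (suc k))) ⟩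
  suc m ℕ.* (m C k) ℕ.+ suc m ℕ.* (m C suc k) ℕ.+ A ≡⟨ ≡.cong (ℕ._+ A) (ℕ.*-distribˡ-+ (suc m) (m C k) (m C suc k)) ⟨
  suc m ℕ.* (m C k ℕ.+ m C suc k) ℕ.+ A   ≡⟨ ≡.cong (λ c → suc m ℕ.* c ℕ.+ A) (nCk+nC[k+1]≡[n+1]C[k+1] m k) ⟩
  suc m ℕ.* A ℕ.+ A                       ≡⟨ ℕ.+-comm (suc m ℕ.* A) A ⟩
  suc (suc m) ℕ.* A                       ∎
  where
  open ≡.≡-Reasoning
  2+k = suc (suc k)
  A = suc m C suc k
  B = suc m C 2+k
  regroup : ∀ k a b → suc (suc k) ℕ.* (a ℕ.+ b) ≡ suc k ℕ.* a ℕ.+ suc (suc k) ℕ.* b ℕ.+ a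
  regroup = solve-∀

-- The absorption identity shows that the prime divides `suc k ℕ.* (suc n C suc k)`, and `suc k` is
-- too small to be a multiple of it.
prime∣pC[k+1] : ∀ {n k} → Prime (suc n) → k ℕ.< n → suc n ∣ (suc n C suc k)
prime∣pC[k+1] {n} {k} p-prime k<n
  with euclidsLemma (suc k) (suc n C suc k) p-prime
         (≡.subst (suc n ∣_) (≡.sym ([k+1]*[n+1]C[k+1]≡[n+1]*nCk n k)) (m∣m*n (n C k)))
... | inj₁ p∣k+1 = contradiction (∣⇒≤ p∣k+1) (ℕ.<⇒≱ (ℕ.s<s k<n))
... | inj₂ p∣C   = p∣C

module _ {c ℓ} (M : CommutativeMonoid c ℓ) where
  open CommutativeMonoid M
  open Sum M
  open import Algebra.Properties.CommutativeMonoid.Mult M using () renaming (_×_ to _•_)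
  open import Relation.Binary.Reasoning.Setoid setoid

  -- The extra summand `a` takes the place of the trivial one at `i`, so the multiple is by n itself
  -- and n - 1 never occurs. In the multiplicative monoid this is what produces x^n rather than
  -- x^(n-1).
  sum-constantExcept : ∀ {n} (t : Vector Carrier n) a i → t i ≈ ε → (∀ j → j ≢ i → t j ≈ a) →
                       a ∙ sum t ≈ n • a
  sum-constantExcept {suc n} t a i tᵢ≈ε tⱼ≈a = ∙-congˡ (begin
    sum t                                ≈⟨ sum-remove {i = i} t ⟩
    t i ∙ sum (Vector.removeAt t i)      ≈⟨ ∙-cong tᵢ≈ε (sum-cong-≋ (λ j → tⱼ≈a (Fin.punchIn i j) (Fin.punchInᵢ≢i i j))) ⟩
    ε ∙ sum (Vector.replicate n a)       ≈⟨ identityˡ _ ⟩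
    sum (Vector.replicate n a)           ≈⟨ sum-replicate n ⟩
    n • a                                ∎)

-- Additivity of Frobenius powers in prime characteristic.

module PrimeCharacteristic {c ℓ} (R : CommutativeRing c ℓ) where
  open CommutativeRing R hiding (zero)
  open Exp commutativeSemiring
  open Mult semiring using (×-congʳ; ×-assoc-*; ×-assocˡ; ×-homo-1) renaming (_×_ to _•_)
  open import Relation.Binary.Reasoning.Setoid setoid
  open Sum +-commutativeMonoid using (sum; sum-init-last; sum-cong-≋; sum-replicate-zero)
  open Binomial commutativeSemiring using (theorem; binomial; binomialTerm)

  n•0≈0 : ∀ n → n • 0# ≈ 0#
  n•0≈0 zero    = refl
  n•0≈0 (suc n) = trans (+-identityˡ _) (n•0≈0 n)

  module _ {p : ℕ} (p-prime : Prime p) (p•1≈0 : p • 1# ≈ 0#) where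

    multiple•≈0 : ∀ {m} → p ∣ m → ∀ x → m • x ≈ 0#
    multiple•≈0 (divides k ≡.refl) x = begin
      (k ℕ.* p) • x          ≈⟨ ×-assocˡ x k p ⟨
      k • (p • x)            ≈⟨ ×-congʳ k (×-congʳ p (*-identityˡ x)) ⟨
      k • (p • (1# * x))     ≈⟨ ×-congʳ k (×-assoc-* p 1# x) ⟨
      k • ((p • 1#) * x)     ≈⟨ ×-congʳ k (trans (*-congʳ p•1≈0) (zeroˡ x)) ⟩
      k • 0#                 ≈⟨ n•0≈0 k ⟩
      0#                     ∎

    ^p-+ : ∀ x y → (x + y) ^ p ≈ x ^ p + y ^ p
    ^p-+ x y = helper p p-prime ≡.refl
      where
      -- The exponent becomes a variable of its own, so that it can be split as a successor; zero is
      -- excluded by primality.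
      helper : ∀ r → Prime r → r ≡ p → (x + y) ^ r ≈ x ^ r + y ^ r
      helper zero r-prime _ = contradiction (prime⇒nonTrivial r-prime) λ ()
      helper (suc n) r-prime ≡.refl = begin
        (x + y) ^ suc n                            ≈⟨ theorem (suc n) x y ⟩
        t zero + sum (t ∘ suc)                     ≈⟨ +-cong first (sum-init-last (t ∘ suc)) ⟩
        y ^ suc n + (sum (λ i → t (suc (inject₁ i))) + t (suc (Fin.fromℕ n)))
          ≈⟨ +-congˡ (+-cong (trans (sum-cong-≋ middle) (sum-replicate-zero n)) last) ⟩
        y ^ suc n + (0# + x ^ suc n)               ≈⟨ +-congˡ (+-identityˡ _) ⟩
        y ^ suc n + x ^ suc n                      ≈⟨ +-comm _ _ ⟩
        x ^ suc n + y ^ suc n                      ∎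
        where
        t = binomialTerm x y (suc n)
        first : t zero ≈ y ^ suc n
        first = trans (×-homo-1 _) (*-identityˡ _)
        middle : ∀ i → t (suc (inject₁ i)) ≈ 0#
        middle i = multiple•≈0
          (prime∣pC[k+1] r-prime (≡.subst (ℕ._< n) (≡.sym (Fin.toℕ-inject₁ i)) (Fin.toℕ<n i)))
          (binomial x y (suc n) (suc (inject₁ i)))
        last : t (suc (Fin.fromℕ n)) ≈ x ^ suc n
        last rewrite Fin.toℕ-fromℕ n | nCn≡1 (suc n) | ℕ.n∸n≡0 n =
          trans (×-homo-1 _) (*-identityʳ _)

    ^pᵏ-+ : ∀ k x y → (x + y) ^ (p ℕ.^ k) ≈ x ^ (p ℕ.^ k) + y ^ (p ℕ.^ k)
    ^pᵏ-+ zero    x y = trans (*-identityʳ _) (sym (+-cong (*-identityʳ x) (*-identityʳ y)))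
    ^pᵏ-+ (suc k) x y = begin
      (x + y) ^ (p ℕ.* p ℕ.^ k)                        ≈⟨ ^-assocʳ (x + y) p (p ℕ.^ k) ⟨
      ((x + y) ^ p) ^ (p ℕ.^ k)                        ≈⟨ ^-congˡ (p ℕ.^ k) (^p-+ x y) ⟩
      (x ^ p + y ^ p) ^ (p ℕ.^ k)                      ≈⟨ ^pᵏ-+ k (x ^ p) (y ^ p) ⟩
      (x ^ p) ^ (p ℕ.^ k) + (y ^ p) ^ (p ℕ.^ k)        ≈⟨ +-cong (^-assocʳ x p (p ℕ.^ k)) (^-assocʳ y p (p ℕ.^ k)) ⟩
      x ^ (p ℕ.* p ℕ.^ k) + y ^ (p ℕ.* p ℕ.^ k)        ∎

-- Finite fields: decidability, inverses, characteristic, and x^n = x.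

module FiniteFieldProperties {c ℓ a n} (F : FiniteField c ℓ a n) where
  open FiniteField F using (heytingField; enumeration)
  open HeytingField heytingField using (heytingCommutativeRing; tight; #⇒invertible)
  open CommutativeRing (FiniteField.commutativeRing F) hiding (zero)
  open RingProperties ring
  open Exp commutativeSemiring
  open import Relation.Binary.Reasoning.Setoid setoid
  open Mult semiring using (×1-homo-*; ×-homo-1) renaming (_×_ to _•_)

  elem : Fin n → Carrier
  elem = Inverse.to enumeration

  index : Carrier → Fin n
  index = Inverse.from enumeration

  elem-index : ∀ x → elem (index x) ≈ x
  elem-index x = Inverse.strictlyInverseˡ enumeration x

  index-elem : ∀ i → index (elem i) ≡ i
  index-elem i = Inverse.strictlyInverseʳ enumeration i

  index-cong : ∀ {x y} → x ≈ y → index x ≡ index y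
  index-cong = Inverse.from-cong enumeration

  index-injective : ∀ {x y} → index x ≡ index y → x ≈ y
  index-injective {x} {y} eq = begin
    x               ≈⟨ elem-index x ⟨
    elem (index x)  ≡⟨ ≡.cong elem eq ⟩
    elem (index y)  ≈⟨ elem-index y ⟩
    y               ∎

  infix 4 _≟_
  _≟_ : ∀ x y → Dec (x ≈ y)
  x ≟ y = map′ index-injective index-cong (index x Fin.≟ index y)

  ∃? : ∀ {p} {P : Pred Carrier p} → P Respects _≈_ → (∀ x → Dec (P x)) → Dec (∃ P)
  ∃? resp P? = map′ (λ (i , p) → elem i , p)
                    (λ (x , p) → index x , resp (sym (elem-index x)) p)
                    (Fin.any? (P? ∘ elem))

  1≉0 : ¬ 1# ≈ 0#
  1≉0 1≈0 = proj₂ (tight _ _) 1≈0 (Heyting.1#0 heytingCommutativeRing)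

  -- From x ≉ 0 tightness yields only the double negation of apartness. Whether an inverse exists is
  -- decidable by searching the field, which removes the double negation.
  inverse : ∀ {x} → ¬ x ≈ 0# → ∃[ y ] y * x ≈ 1#
  inverse {x} x≉0 = decidable-stable (∃? (λ y≈z → trans (*-congʳ (sym y≈z))) (λ y → y * x ≟ 1#))
    λ ∄ → x≉0 (proj₁ (tight x 0#) λ x#0 → ∄ (invert (#⇒invertible x#0)))
    where
    invert : (∃[ y ] y * (x - 0#) ≈ 1# × (x - 0#) * y ≈ 1#) → ∃[ y ] y * x ≈ 1#
    invert (y , yx≈1 , _) =
      y , trans (*-congˡ (sym (trans (+-congˡ -0#≈0#) (+-identityʳ x)))) yx≈1

  *-cancelˡ-≉0 : ∀ {x y z} → ¬ x ≈ 0# → x * y ≈ x * z → y ≈ z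
  *-cancelˡ-≉0 {x} {y} {z} x≉0 xy≈xz with x⁻¹ , x⁻¹x≈1 ← inverse x≉0 = begin
    y               ≈⟨ *-identityˡ y ⟨
    1# * y          ≈⟨ *-congʳ x⁻¹x≈1 ⟨
    x⁻¹ * x * y     ≈⟨ *-assoc x⁻¹ x y ⟩
    x⁻¹ * (x * y)   ≈⟨ *-congˡ xy≈xz ⟩
    x⁻¹ * (x * z)   ≈⟨ *-assoc x⁻¹ x z ⟨
    x⁻¹ * x * z     ≈⟨ *-congʳ x⁻¹x≈1 ⟩
    1# * z          ≈⟨ *-identityˡ z ⟩
    z               ∎

  xy≈0⇒x≈0∨y≈0 : ∀ {x y} → x * y ≈ 0# → x ≈ 0# ⊎ y ≈ 0#
  xy≈0⇒x≈0∨y≈0 {x} {y} xy≈0 with x ≟ 0#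
  ... | yes x≈0 = inj₁ x≈0
  ... | no  x≉0 = inj₂ (*-cancelˡ-≉0 x≉0 (trans xy≈0 (sym (zeroʳ x))))

  -- Translation by 1 permutes the field, so the sum s of all its elements equals s + n·1.
  n•1≈0 : n • 1# ≈ 0#
  n•1≈0 = begin
    n • 1#                  ≈⟨ +-identityˡ _ ⟨
    0# + n • 1#             ≈⟨ +-congʳ (-‿inverseˡ s) ⟨
    - s + s + n • 1#        ≈⟨ +-assoc _ _ _ ⟩
    - s + (s + n • 1#)      ≈⟨ +-congˡ (+-congˡ (sum-replicate n)) ⟨
    - s + (s + sum (Vector.replicate n 1#))  ≈⟨ +-congˡ (∑-distrib-+ elem _) ⟨
    - s + sum (λ i → elem i + 1#)            ≈⟨ +-congˡ (sum-cong-≋ (λ i → elem-index (elem i + 1#))) ⟨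
    - s + sum (λ i → elem (index (elem i + 1#)))  ≈⟨ +-congˡ (sum-permute elem shift) ⟨
    - s + s                 ≈⟨ -‿inverseˡ s ⟩
    0#                      ∎
    where
    open Sum +-commutativeMonoid
    s = sum elem
    cancel : ∀ {u v} → u + v ≈ 0# → ∀ i → index (elem (index (elem i + u)) + v) ≡ i
    cancel {u} {v} u+v≈0 i = ≡.trans (index-cong (begin
      elem (index (elem i + u)) + v  ≈⟨ +-congʳ (elem-index _) ⟩
      elem i + u + v                 ≈⟨ +-assoc _ _ _ ⟩
      elem i + (u + v)               ≈⟨ +-congˡ u+v≈0 ⟩
      elem i + 0#                    ≈⟨ +-identityʳ _ ⟩
      elem i                         ∎)) (index-elem i)
    shift = permutation (λ i → index (elem i + 1#)) (λ i → index (elem i + - 1#))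
              (cancel (-‿inverseˡ 1#)) (cancel (-‿inverseʳ 1#))

  -- n·1 = 0 factors as the k-th power of p·1, and there are no zero divisors.
  characteristic : ∀ {p} k → n ≡ p ℕ.^ k → p • 1# ≈ 0#
  characteristic {p} k n≡p^k = descend k (≡.subst (λ m → m • 1# ≈ 0#) n≡p^k n•1≈0)
    where
    descend : ∀ j → (p ℕ.^ j) • 1# ≈ 0# → p • 1# ≈ 0#
    descend zero    1•1≈0 = contradiction (trans (sym (×-homo-1 1#)) 1•1≈0) 1≉0
    descend (suc j) p^•1≈0 with xy≈0⇒x≈0∨y≈0 (trans (sym (×1-homo-* p (p ℕ.^ j))) p^•1≈0)
    ... | inj₁ p•1≈0  = p•1≈0
    ... | inj₂ p^j≈0  = descend j p^j≈0

  x^n≈x : ∀ x → x ^ n ≈ x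
  x^n≈x x with x ≟ 0#
  ... | yes x≈0 = trans (^-congˡ n x≈0) (trans (0^ n (index 0#)) (sym x≈0))
    where
    -- The index rules out m = 0, where the power would be 1; `index 0#` supplies it.
    0^ : ∀ m → Fin m → 0# ^ m ≈ 0#
    0^ (suc m) _ = zeroˡ _
  ... | no  x≉0 = begin
    x ^ n            ≈⟨ sum-constantExcept *-commutativeMonoid (factor ∘ elem) x (index 0#) (factor-0 (elem-index 0#))
                          (λ j j≢0 → factor-≉0 (λ eⱼ≈0 → j≢0 (≡.trans (≡.sym (index-elem j)) (index-cong eⱼ≈0)))) ⟨
    x * ∏ (factor ∘ elem)  ≈⟨ *-congˡ ∏factor≈1 ⟩
    x * 1#           ≈⟨ *-identityʳ x ⟩
    x                ∎
    where
    open Sum *-commutativeMonoid renaming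
      (sum to ∏; sum-permute to ∏-permute; sum-cong-≋ to ∏-cong; ∑-distrib-+ to ∏-distrib)
    select : Carrier → Carrier → Carrier
    select y z with z ≟ 0#
    ... | yes _ = 1#
    ... | no  _ = y
    select-0 : ∀ {y z} → z ≈ 0# → select y z ≈ 1#
    select-0 {y} {z} z≈0 with z ≟ 0#
    ... | yes _   = refl
    ... | no  z≉0 = contradiction z≈0 z≉0
    select-≉0 : ∀ {y z} → ¬ z ≈ 0# → select y z ≈ y
    select-≉0 {y} {z} z≉0 with z ≟ 0#
    ... | yes z≈0 = contradiction z≈0 z≉0
    ... | no  _   = refl
    -- Both replace the entry at 0 by 1, so that products over the whole enumeration are products
    -- over the nonzero elements.
    factor nonzero : Carrier → Carrier
    factor = select x
    nonzero z = select z z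
    factor-0 : ∀ {z} → z ≈ 0# → factor z ≈ 1#
    factor-0 = select-0
    factor-≉0 : ∀ {z} → ¬ z ≈ 0# → factor z ≈ x
    factor-≉0 = select-≉0
    nonzero-≉0 : ∀ z → ¬ nonzero z ≈ 0#
    nonzero-≉0 z with z ≟ 0#
    ... | yes _   = 1≉0
    ... | no  z≉0 = z≉0
    nonzero-x* : ∀ z → nonzero (elem (index (x * z))) ≈ factor z * nonzero z
    nonzero-x* z with z ≟ 0#
    ... | yes z≈0 = trans (select-0 (trans (elem-index _) (trans (*-congˡ z≈0) (zeroʳ x))))
                          (sym (*-identityʳ 1#))
    ... | no  z≉0 = trans (select-≉0 λ xz≈0 → z≉0 (*-cancelˡ-≉0 x≉0
                             (trans (sym (elem-index _)) (trans xz≈0 (sym (zeroʳ x))))))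
                          (elem-index _)
    ∏-≉0 : ∀ {m} (t : Vector Carrier m) → (∀ i → ¬ t i ≈ 0#) → ¬ ∏ t ≈ 0#
    ∏-≉0 {zero}  t t≉0 = 1≉0
    ∏-≉0 {suc m} t t≉0 ∏≈0 with xy≈0⇒x≈0∨y≈0 ∏≈0
    ... | inj₁ t₀≈0 = t≉0 zero t₀≈0
    ... | inj₂ ∏≈0′ = ∏-≉0 (t ∘ suc) (t≉0 ∘ suc) ∏≈0′
    x⁻¹ = proj₁ (inverse x≉0)
    cancel : ∀ {u v} → v * u ≈ 1# → ∀ i → index (v * elem (index (u * elem i))) ≡ i
    cancel {u} {v} vu≈1 i = ≡.trans (index-cong (begin
      v * elem (index (u * elem i))  ≈⟨ *-congˡ (elem-index _) ⟩
      v * (u * elem i)               ≈⟨ *-assoc v u (elem i) ⟨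
      v * u * elem i                 ≈⟨ *-congʳ vu≈1 ⟩
      1# * elem i                    ≈⟨ *-identityˡ _ ⟩
      elem i                         ∎)) (index-elem i)
    scaling = permutation (λ i → index (x * elem i)) (λ i → index (x⁻¹ * elem i))
                (cancel (trans (*-comm x x⁻¹) (proj₂ (inverse x≉0)))) (cancel (proj₂ (inverse x≉0)))
    -- Multiplication by x permutes the nonzero elements.
    ∏factor≈1 : ∏ (factor ∘ elem) ≈ 1#
    ∏factor≈1 = *-cancelˡ-≉0 (∏-≉0 (nonzero ∘ elem) (nonzero-≉0 ∘ elem)) (begin
      ∏ (nonzero ∘ elem) * ∏ (factor ∘ elem)         ≈⟨ *-comm _ _ ⟩
      ∏ (factor ∘ elem) * ∏ (nonzero ∘ elem)         ≈⟨ ∏-distrib (factor ∘ elem) (nonzero ∘ elem) ⟨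
      ∏ (λ i → factor (elem i) * nonzero (elem i))   ≈⟨ ∏-cong (nonzero-x* ∘ elem) ⟨
      ∏ (λ i → nonzero (elem (index (x * elem i))))  ≈⟨ ∏-permute (nonzero ∘ elem) scaling ⟨
      ∏ (nonzero ∘ elem)                             ≈⟨ *-identityʳ _ ⟨
      ∏ (nonzero ∘ elem) * 1#                        ∎)

-- The number of roots of a monic polynomial.

-- Coefficient lists represent monic polynomials: [c₀,…,cₙ₋₁] stands for c₀ + c₁x + ⋯ + cₙ₋₁xⁿ⁻¹ + xⁿ.
module MonicPolynomial {c ℓ} (R : CommutativeRing c ℓ) where
  open CommutativeRing R hiding (zero)
  open RingProperties ring
  open Solver commutativeSemiring
  open import Relation.Binary.Reasoning.Setoid setoid

  eval : ∀ {n} → Vec Carrier n → Carrier → Carrier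
  eval []       x = 1#
  eval (c ∷ cs) x = c + x * eval cs x

  -- Synthetic division by x - r: the coefficients of the quotient are the intermediate values of
  -- Horner's scheme at r.
  quotient : ∀ {n} → Carrier → Vec Carrier (suc n) → Vec Carrier n
  quotient r (c ∷ [])      = []
  quotient r (c ∷ d ∷ cs)  = eval (d ∷ cs) r ∷ quotient r (d ∷ cs)

  -- p(x) − p(r) = (x − r) q(x), with both sides moved so that no subtraction occurs.
  eval-quotient : ∀ {n} r (cs : Vec Carrier (suc n)) x →
    eval cs x + r * eval (quotient r cs) x ≈ eval cs r + x * eval (quotient r cs) x
  eval-quotient r (c ∷ []) x =
    solve 3 (λ c x r → c :+ x :* con 1 :+ r :* con 1 := c :+ r :* con 1 :+ x :* con 1) refl c x r
  eval-quotient r (c ∷ ds@(d ∷ cs)) x = begin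
    (c + x * eval ds x) + r * (eval ds r + x * q)
      ≈⟨ solve 6 (λ c x r p s q → (c :+ x :* p) :+ r :* (s :+ x :* q)
                               := (c :+ r :* s) :+ x :* (p :+ r :* q)) refl c x r (eval ds x) (eval ds r) q ⟩
    (c + r * eval ds r) + x * (eval ds x + r * q)
      ≈⟨ +-congˡ (*-congˡ (eval-quotient r ds x)) ⟩
    (c + r * eval ds r) + x * (eval ds r + x * q) ∎
    where q = eval (quotient r ds) x

  module _ (xy≈0⇒x≈0∨y≈0 : ∀ {x y} → x * y ≈ 0# → x ≈ 0# ⊎ y ≈ 0#) (1≉0 : ¬ 1# ≈ 0#) where

    -- Dividing out the first root leaves the other, distinct ones as roots of the quotient, since
    -- there are no zero divisors. Monicity is preserved, so the descent ends at the constant 1.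
    ¬degree+1-roots : ∀ {n} (cs : Vec Carrier n) (r : Vector Carrier (suc n)) →
                      (∀ {i j} → r i ≈ r j → i ≡ j) → ¬ (∀ i → eval cs (r i) ≈ 0#)
    ¬degree+1-roots []           r r-inj root = 1≉0 (root zero)
    ¬degree+1-roots cs@(_ ∷ _)   r r-inj root =
      ¬degree+1-roots (quotient (r zero) cs) (r ∘ suc) (Fin.suc-injective ∘ r-inj) quotient-root
      where
      quotient-root : ∀ i → eval (quotient (r zero) cs) (r (suc i)) ≈ 0#
      quotient-root i with xy≈0⇒x≈0∨y≈0 (begin
        (r (suc i) - r zero) * q                ≈⟨ distribʳ _ _ _ ⟩
        r (suc i) * q + - r zero * q            ≈⟨ +-cong rᵢq≈r₀q (sym (-‿distribˡ-* _ _)) ⟩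
        r zero * q - r zero * q                 ≈⟨ -‿inverseʳ _ ⟩
        0#                                      ∎)
        where
        q = eval (quotient (r zero) cs) (r (suc i))
        rᵢq≈r₀q : r (suc i) * q ≈ r zero * q
        rᵢq≈r₀q = begin
          r (suc i) * q                     ≈⟨ +-identityˡ _ ⟨
          0# + r (suc i) * q                ≈⟨ +-congʳ (root zero) ⟨
          eval cs (r zero) + r (suc i) * q  ≈⟨ eval-quotient (r zero) cs (r (suc i)) ⟨
          eval cs (r (suc i)) + r zero * q  ≈⟨ +-congʳ (root (suc i)) ⟩
          0# + r zero * q                   ≈⟨ +-identityˡ _ ⟩
          r zero * q                        ∎
      ... | inj₁ rᵢ-r₀≈0 = contradiction (r-inj (x∙y⁻¹≈ε⇒x≈y _ _ rᵢ-r₀≈0)) λ ()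
      ... | inj₂ q≈0     = q≈0

-- The conjugate equations for an endomorphism σ with σ⁸ = 1.

module CyclicExtension {c ℓ} (R : CommutativeRing c ℓ) where
  open CommutativeRing R
  open RingProperties ring
  open Solver commutativeSemiring
  open import Relation.Binary.Reasoning.Setoid setoid

  module Conjugates
    (xy≈0⇒x≈0∨y≈0 : ∀ {x y} → x * y ≈ 0# → x ≈ 0# ⊎ y ≈ 0#)
    (2≉0 : ¬ 1# + 1# ≈ 0#)
    (σ : Carrier → Carrier)
    (σ-cong : ∀ {x y} → x ≈ y → σ x ≈ σ y)
    (σ-+ : ∀ x y → σ (x + y) ≈ σ x + σ y)
    (σ-* : ∀ x y → σ (x * y) ≈ σ x * σ y)
    where

    σ² σ⁴ σ⁵ : Carrier → Carrier
    σ² x = σ (σ x)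
    σ⁴ x = σ² (σ² x)
    σ⁵ x = σ⁴ (σ x)

    σ⁴-cong : ∀ {x y} → x ≈ y → σ⁴ x ≈ σ⁴ y
    σ⁴-cong x≈y = σ-cong (σ-cong (σ-cong (σ-cong x≈y)))

    σ-0 : σ 0# ≈ 0#
    σ-0 = +-cancelʳ (σ 0#) _ _ (trans (sym (σ-+ 0# 0#)) (trans (σ-cong (+-identityʳ 0#)) (sym (+-identityˡ _))))

    [x-y][z-w] : ∀ x y z w → (x - y) * (z - w) ≈ (x * z + y * w) - (x * w + y * z)
    [x-y][z-w] x y z w = begin
      (x - y) * (z - w)
        -- The negatives enter the semiring identity as independent unknowns; the sign rules follow
        -- separately.
        ≈⟨ solve 4 (λ x y′ z w′ → (x :+ y′) :* (z :+ w′) := x :* z :+ y′ :* z :+ x :* w′ :+ y′ :* w′) refl x (- y) z (- w) ⟩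
      x * z + - y * z + x * - w + - y * - w
        ≈⟨ +-cong (+-cong (+-congˡ (sym (-‿distribˡ-* y z))) (sym (-‿distribʳ-* x w)))
             (trans (sym (-‿distribˡ-* y (- w))) (trans (-‿cong (sym (-‿distribʳ-* y w))) (-‿involutive _))) ⟩
      x * z + - (y * z) + - (x * w) + y * w
        ≈⟨ solve 4 (λ a b′ c′ d → a :+ b′ :+ c′ :+ d := (a :+ d) :+ (c′ :+ b′)) refl (x * z) (- (y * z)) (- (x * w)) (y * w) ⟩
      (x * z + y * w) + (- (x * w) + - (y * z))
        ≈⟨ +-congˡ (-‿+-comm _ _) ⟩
      (x * z + y * w) - (x * w + y * z) ∎

    x+v≈y+u⇒x-y≈u-v : ∀ {x y u v} → x + v ≈ y + u → x - y ≈ u - v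
    x+v≈y+u⇒x-y≈u-v {x} {y} {u} {v} eq = begin
      x - y                    ≈⟨ +-identityʳ _ ⟨
      x - y + 0#               ≈⟨ +-congˡ (-‿inverseʳ v) ⟨
      x - y + (v - v)          ≈⟨ solve 4 (λ x y′ v v′ → x :+ y′ :+ (v :+ v′) := (x :+ v) :+ (y′ :+ v′)) refl x (- y) v (- v) ⟩
      (x + v) + (- y - v)      ≈⟨ +-congʳ eq ⟩
      (y + u) + (- y - v)      ≈⟨ solve 4 (λ y u y′ v′ → (y :+ u) :+ (y′ :+ v′) := (u :+ v′) :+ (y :+ y′)) refl y u (- y) (- v) ⟩
      (u - v) + (y - y)        ≈⟨ trans (+-congˡ (-‿inverseʳ y)) (+-identityʳ _) ⟩
      u - v                    ∎

    x-y≈u-v⇒x+v≈y+u : ∀ {x y u v} → x - y ≈ u - v → x + v ≈ y + u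
    x-y≈u-v⇒x+v≈y+u {x} {y} {u} {v} eq = begin
      x + v                    ≈⟨ +-identityʳ _ ⟨
      x + v + 0#               ≈⟨ +-congˡ (-‿inverseʳ y) ⟨
      x + v + (y - y)          ≈⟨ solve 4 (λ x v y y′ → x :+ v :+ (y :+ y′) := (x :+ y′) :+ (y :+ v)) refl x v y (- y) ⟩
      (x - y) + (y + v)        ≈⟨ +-congʳ eq ⟩
      (u - v) + (y + v)        ≈⟨ solve 4 (λ u v′ y v → (u :+ v′) :+ (y :+ v) := (y :+ u) :+ (v :+ v′)) refl u (- v) y v ⟩
      (y + u) + (v - v)        ≈⟨ trans (+-congˡ (-‿inverseʳ v)) (+-identityʳ _) ⟩
      y + u                    ∎

    -- (x − y)(z − w) = 0
    crossed : ∀ {x y z w} → x * z + y * w ≈ x * w + y * z → x ≈ y ⊎ z ≈ w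
    crossed {x} {y} {z} {w} eq
      with xy≈0⇒x≈0∨y≈0 (trans ([x-y][z-w] x y z w) (x≈y⇒x∙y⁻¹≈ε eq))
    ... | inj₁ x-y≈0 = inj₁ (x∙y⁻¹≈ε⇒x≈y _ _ x-y≈0)
    ... | inj₂ z-w≈0 = inj₂ (x∙y⁻¹≈ε⇒x≈y _ _ z-w≈0)

    *-cancelˡ′ : ∀ {x y z} → ¬ x ≈ 0# → x * y ≈ x * z → y ≈ z
    *-cancelˡ′ {x} {y} {z} x≉0 xy≈xz with crossed {x} {0#} {y} {z}
      (+-cong xy≈xz (trans (zeroˡ z) (sym (zeroˡ y))))
    ... | inj₁ x≈0 = contradiction x≈0 x≉0
    ... | inj₂ y≈z = y≈z

    module _ (σ⁸ : ∀ x → σ⁴ (σ⁴ x) ≈ x) where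

      fixed : ∀ l → (let l′ = σ l) →
        (1# + 1#) * (l * σ⁴ l + l′ * σ⁴ l′) ≈ (l + σ⁴ l) * (l′ + σ⁴ l′) → l′ ≈ l
      fixed l₀ eq₀ = sym l₀≈l₁
        where
        l₁ = σ l₀; l₂ = σ l₁; l₃ = σ l₂; l₄ = σ l₃; l₅ = σ l₄; l₆ = σ l₅; l₇ = σ l₆; l₈ = σ l₇

        A₀ = l₀ + l₄; A₁ = l₁ + l₅; A₂ = l₂ + l₆; A₃ = l₃ + l₇
        P₀ = l₀ * l₄; P₁ = l₁ * l₅; P₂ = l₂ * l₆; P₃ = l₃ * l₇

        2× : Carrier → Carrier
        2× x = (1# + 1#) * x

        Rel : (a b c d : Carrier) → Set ℓ
        Rel a b c d = (1# + 1#) * (a * b + c * d) ≈ (a + b) * (c + d)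

        conjugate : ∀ {a b c d} → Rel a b c d → Rel (σ a) (σ b) (σ c) (σ d)
        conjugate {a} {b} {c} {d} eq = begin
          (1# + 1#) * (σ a * σ b + σ c * σ d)
            ≈⟨ double _ ⟩
          (σ a * σ b + σ c * σ d) + (σ a * σ b + σ c * σ d)
            ≈⟨ +-cong σs σs ⟨
          σ (a * b + c * d) + σ (a * b + c * d)  ≈⟨ σ-+ _ _ ⟨
          σ ((a * b + c * d) + (a * b + c * d))  ≈⟨ σ-cong (double _) ⟨
          σ ((1# + 1#) * (a * b + c * d))        ≈⟨ σ-cong eq ⟩
          σ ((a + b) * (c + d))                  ≈⟨ σ-* _ _ ⟩
          σ (a + b) * σ (c + d)                  ≈⟨ *-cong (σ-+ a b) (σ-+ c d) ⟩
          (σ a + σ b) * (σ c + σ d)              ∎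
          where
          double : ∀ x → (1# + 1#) * x ≈ x + x
          double x = solve 1 (λ x → (con 1 :+ con 1) :* x := x :+ x) refl x
          σs : σ (a * b + c * d) ≈ σ a * σ b + σ c * σ d
          σs = trans (σ-+ _ _) (+-cong (σ-* a b) (σ-* c d))

        eq₁ : Rel l₁ l₅ l₂ l₆
        eq₁ = conjugate eq₀
        eq₂ : Rel l₂ l₆ l₃ l₇
        eq₂ = conjugate eq₁
        eq₃ : Rel l₃ l₇ l₄ l₀
        -- Here the cycle closes: the conjugate of `l₇` is `l₈`, which `σ⁸` identifies with `l₀`.
        eq₃ = trans (*-congˡ (+-congˡ (*-congˡ (sym (σ⁸ l₀))))) (trans (conjugate eq₂) (*-congˡ (+-congˡ (σ⁸ l₀))))

        -- Around the 4-cycle of the A's, the two products on opposite edges add up to 2(P₀ + P₁ +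
        -- P₂ + P₃), whichever pair of opposite edges is taken.
        A₀≈A₂∨A₁≈A₃ : l₀ + l₄ ≈ l₂ + l₆ ⊎ l₁ + l₅ ≈ l₃ + l₇
        A₀≈A₂∨A₁≈A₃ = crossed (begin
          A₀ * A₁ + A₂ * A₃                  ≈⟨ +-cong eq₀ eq₂ ⟨
          2× (P₀ + P₁) + 2× (P₂ + P₃)        ≈⟨ regroup P₀ P₁ P₂ P₃ ⟩
          2× (P₃ + P₀) + 2× (P₁ + P₂)        ≈⟨ +-cong (trans (*-congˡ (+-congˡ (*-comm l₀ l₄))) eq₃) eq₁ ⟩
          A₃ * (l₄ + l₀) + A₁ * A₂           ≈⟨ +-cong (trans (*-comm A₃ _) (*-congʳ (+-comm l₄ l₀))) (*-comm A₁ A₂) ⟩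
          A₀ * A₃ + A₂ * A₁                  ∎)
          where
          regroup : ∀ a b c d → 2× (a + b) + 2× (c + d) ≈ 2× (d + a) + 2× (b + c)
          regroup = solve 4 (λ a b c d → (con 1 :+ con 1) :* (a :+ b) :+ (con 1 :+ con 1) :* (c :+ d)
            := (con 1 :+ con 1) :* (d :+ a) :+ (con 1 :+ con 1) :* (b :+ c)) refl

        A₀≈A₂ : l₀ + l₄ ≈ l₂ + l₆
        -- The second alternative is a conjugate of the first: σ carries A₁ = A₃ to A₂ = A₀, because
        -- σ⁸ = 1.
        A₀≈A₂ = [ id , (λ A₁≈A₃ → begin
          l₀ + l₄        ≈⟨ +-comm l₀ l₄ ⟩
          l₄ + l₀        ≈⟨ +-congˡ (σ⁸ l₀) ⟨
          σ l₃ + σ l₇    ≈⟨ σ-+ l₃ l₇ ⟨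
          σ (l₃ + l₇)    ≈⟨ σ-cong A₁≈A₃ ⟨
          σ (l₁ + l₅)    ≈⟨ σ-+ l₁ l₅ ⟩
          l₂ + l₆        ∎) ]′ A₀≈A₂∨A₁≈A₃

        -- The relations for (0, 1) and (1, 2) now have equal right-hand sides and share P₁;
        -- cancelling 2 compares the remaining terms.
        P₀≈P₂ : l₀ * l₄ ≈ l₂ * l₆
        P₀≈P₂ = +-cancelʳ P₁ P₀ P₂ (trans (*-cancelˡ′ 2≉0 (begin
          2× (P₀ + P₁)  ≈⟨ eq₀ ⟩
          A₀ * A₁       ≈⟨ *-congʳ A₀≈A₂ ⟩
          A₂ * A₁       ≈⟨ *-comm A₂ A₁ ⟩
          A₁ * A₂       ≈⟨ eq₁ ⟨
          2× (P₁ + P₂)  ∎)) (+-comm P₁ P₂))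

        -- `l₀` is a root of T² - A₀T + P₀, which is now also (T - l₂)(T - l₆).
        l₀≈l₂∨l₀≈l₆ : l₀ ≈ l₂ ⊎ l₀ ≈ l₆
        l₀≈l₂∨l₀≈l₆ = crossed (begin
          l₀ * l₀ + P₂       ≈⟨ +-congˡ P₀≈P₂ ⟨
          l₀ * l₀ + P₀       ≈⟨ distribˡ l₀ l₀ l₄ ⟨
          l₀ * A₀            ≈⟨ *-congˡ A₀≈A₂ ⟩
          l₀ * A₂            ≈⟨ distribˡ l₀ l₂ l₆ ⟩
          l₀ * l₂ + l₀ * l₆  ≈⟨ trans (+-congʳ (*-comm l₀ l₂)) (+-comm _ _) ⟩
          l₀ * l₆ + l₂ * l₀  ∎)

        l₀≈l₂ : l₀ ≈ l₂
        -- Applying σ² to `l₀ ≈ l₆` gives `l₂ ≈ l₈`, that is, the first alternative again.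
        l₀≈l₂ = [ id , (λ l₀≈l₆ → sym (trans (σ-cong (σ-cong l₀≈l₆)) (σ⁸ l₀))) ]′ l₀≈l₂∨l₀≈l₆

        l₄≈l₀ : l₄ ≈ l₀
        l₄≈l₀ = sym (trans l₀≈l₂ (σ-cong (σ-cong l₀≈l₂)))

        l₀≈l₁ : l₀ ≈ l₁
        l₀≈l₁ = reduce (crossed {l₀} {l₁} {l₀} {l₁} (*-cancelˡ′ 2≉0 (begin
          (1# + 1#) * (l₀ * l₀ + l₁ * l₁)  ≈⟨ *-congˡ (+-cong (*-congˡ l₄≈l₀) (*-congˡ (σ-cong l₄≈l₀))) ⟨
          (1# + 1#) * (l₀ * l₄ + l₁ * l₅)  ≈⟨ eq₀ ⟩
          (l₀ + l₄) * (l₁ + l₅)            ≈⟨ *-cong (+-congˡ l₄≈l₀) (+-congˡ (σ-cong l₄≈l₀)) ⟩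
          (l₀ + l₀) * (l₁ + l₁)
            ≈⟨ solve 2 (λ x y → (x :+ x) :* (y :+ y) := (con 1 :+ con 1) :* (x :* y :+ y :* x)) refl l₀ l₁ ⟩
          (1# + 1#) * (l₀ * l₁ + l₁ * l₀)  ∎)))

      σ-≉0 : ∀ {x} → ¬ x ≈ 0# → ¬ σ x ≈ 0#
      σ-≉0 {x} x≉0 σx≈0 = x≉0 (begin
        x                  ≈⟨ σ⁸ x ⟨
        σ⁴ (σ⁴ x)          ≈⟨ σ⁴-cong (σ-cong (σ-cong (σ-cong σx≈0))) ⟩
        σ⁴ (σ (σ (σ 0#)))  ≈⟨ σ⁴-cong (trans (σ-cong (trans (σ-cong σ-0) σ-0)) σ-0) ⟩
        σ⁴ 0#              ≈⟨ trans (σ-cong (trans (σ-cong (trans (σ-cong σ-0) σ-0)) σ-0)) σ-0 ⟩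
        0#                 ∎)

      proportional⇒fixed : ∀ {b x l} → ¬ b ≈ 0# → b * b + 1# ≈ 0# → σ² b ≈ b → ¬ x ≈ 0# →
        b * σ (l * x) + σ⁵ (l * x) ≈ l * (b * σ x + σ⁵ x) → σ l ≈ l
      proportional⇒fixed {b} {x} {l₀} b≉0 b²+1≈0 σ²b≈b x≉0 eq = fixed l₀ (begin
        (1# + 1#) * (l₀ * l₄ + l₁ * l₅)
          ≈⟨ solve 4 (λ l₀ l₁ l₄ l₅ → (con 1 :+ con 1) :* (l₀ :* l₄ :+ l₁ :* l₅)
               := l₁ :* l₅ :+ l₀ :* l₄ :+ (l₀ :* l₄ :+ l₅ :* l₁)) refl l₀ l₁ l₄ l₅ ⟩
        l₁ * l₅ + l₀ * l₄ + (l₀ * l₄ + l₅ * l₁)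
          ≈⟨ x-y≈u-v⇒x+v≈y+u (trans (sym ([x-y][z-w] l₁ l₀ l₅ l₄)) (trans ratio ([x-y][z-w] l₀ l₅ l₁ l₄))) ⟩
        l₁ * l₄ + l₀ * l₅ + (l₀ * l₁ + l₅ * l₄)
          ≈⟨ solve 4 (λ l₀ l₁ l₄ l₅ → l₁ :* l₄ :+ l₀ :* l₅ :+ (l₀ :* l₁ :+ l₅ :* l₄)
               := (l₀ :+ l₄) :* (l₁ :+ l₅)) refl l₀ l₁ l₄ l₅ ⟩
        (l₀ + l₄) * (l₁ + l₅) ∎)
        where
        x₁ = σ x; x₅ = σ⁵ x; l₁ = σ l₀; l₄ = σ⁴ l₀; l₅ = σ l₄
        y = b * x₁
        *-≉0 : ∀ {u v} → ¬ u ≈ 0# → ¬ v ≈ 0# → ¬ u * v ≈ 0#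
        *-≉0 u≉0 v≉0 uv≈0 with xy≈0⇒x≈0∨y≈0 uv≈0
        ... | inj₁ u≈0 = u≉0 u≈0
        ... | inj₂ v≈0 = v≉0 v≈0
        y*x₅≉0 : ¬ y * x₅ ≈ 0#
        y*x₅≉0 = *-≉0 (*-≉0 b≉0 (σ-≉0 x≉0)) (σ-≉0 (σ-≉0 (σ-≉0 (σ-≉0 (σ-≉0 x≉0)))))
        σ²-* : ∀ x y → σ² (x * y) ≈ σ² x * σ² y
        σ²-* x y = trans (σ-cong (σ-* x y)) (σ-* _ _)
        σ⁴-* : ∀ x y → σ⁴ (x * y) ≈ σ⁴ x * σ⁴ y
        σ⁴-* x y = trans (σ-cong (σ-cong (σ²-* x y))) (σ²-* _ _)
        σ²-+ : ∀ x y → σ² (x + y) ≈ σ² x + σ² y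
        σ²-+ x y = trans (σ-cong (σ-+ x y)) (σ-+ _ _)
        σ⁴-+ : ∀ x y → σ⁴ (x + y) ≈ σ⁴ x + σ⁴ y
        σ⁴-+ x y = trans (σ-cong (σ-cong (σ²-+ x y))) (σ²-+ _ _)
        σ⁴b≈b : σ⁴ b ≈ b
        σ⁴b≈b = trans (σ-cong (σ-cong σ²b≈b)) σ²b≈b
        eq₀ : b * (l₁ * x₁) + l₅ * x₅ ≈ l₀ * (b * x₁ + x₅)
        eq₀ = trans (sym (+-cong (*-congˡ (σ-* l₀ x)) (trans (σ⁴-cong (σ-* l₀ x)) (σ⁴-* l₁ x₁)))) eq
        -- σ⁴ swaps the indices 1 and 5 and fixes b, so conjugation introduces no new conjugate of
        -- x.
        eq₄ : b * (l₅ * x₅) + l₁ * x₁ ≈ l₄ * (b * x₅ + x₁)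
        eq₄ = begin
          b * (l₅ * x₅) + l₁ * x₁                     ≈⟨ +-cong (*-cong σ⁴b≈b (σ⁴-* l₁ x₁)) (*-cong (σ⁸ l₁) (σ⁸ x₁)) ⟨
          σ⁴ b * σ⁴ (l₁ * x₁) + σ⁴ l₅ * σ⁴ x₅         ≈⟨ +-cong (σ⁴-* b _) (σ⁴-* l₅ x₅) ⟨
          σ⁴ (b * (l₁ * x₁)) + σ⁴ (l₅ * x₅)           ≈⟨ σ⁴-+ _ _ ⟨
          σ⁴ (b * (l₁ * x₁) + l₅ * x₅)                ≈⟨ σ⁴-cong eq₀ ⟩
          σ⁴ (l₀ * (b * x₁ + x₅))                     ≈⟨ σ⁴-* l₀ _ ⟩
          l₄ * σ⁴ (b * x₁ + x₅)                       ≈⟨ *-congˡ (σ⁴-+ _ _) ⟩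
          l₄ * (σ⁴ (b * x₁) + σ⁴ x₅)                  ≈⟨ *-congˡ (+-cong (trans (σ⁴-* b x₁) (*-congʳ σ⁴b≈b)) (σ⁸ x₁)) ⟩
          l₄ * (b * x₅ + x₁)                          ∎
        factored : ∀ {y z a b c d} → y * a + z * d ≈ y * b + z * c → y * (a - b) ≈ z * (c - d)
        factored {y} {z} {a} {b} {c} {d} eq = begin
          y * (a - b)       ≈⟨ distribˡ y a (- b) ⟩
          y * a + y * - b   ≈⟨ +-congˡ (-‿distribʳ-* y b) ⟨
          y * a - y * b     ≈⟨ x+v≈y+u⇒x-y≈u-v eq ⟩
          z * c - z * d     ≈⟨ +-congˡ (-‿distribʳ-* z d) ⟩
          z * c + z * - d   ≈⟨ distribˡ z c (- d) ⟨
          z * (c - d)       ∎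
        ratio₀ : y * (l₁ - l₀) ≈ x₅ * (l₀ - l₅)
        ratio₀ = factored (begin
          y * l₁ + x₅ * l₅           ≈⟨ +-cong (trans (*-assoc b x₁ l₁) (*-congˡ (*-comm x₁ l₁))) (*-comm x₅ l₅) ⟩
          b * (l₁ * x₁) + l₅ * x₅    ≈⟨ eq₀ ⟩
          l₀ * (y + x₅)              ≈⟨ trans (*-comm l₀ _) (distribʳ l₀ y x₅) ⟩
          y * l₀ + x₅ * l₀           ∎)
        -- The conjugate relation times b: its `x₅` term acquires b² = -1, and its `x₁` term becomes
        -- a multiple of `y`. Like `ratio₀`, it now relates `y` to `x₅`.
        ratio₄ : y * (l₁ - l₄) ≈ x₅ * (l₅ - l₄)
        ratio₄ = trans (factored {y} {z = - x₅} (begin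
          y * l₁ + - x₅ * l₅           ≈⟨ +-congˡ (*-congʳ b²x₅≈-x₅) ⟨
          y * l₁ + b * b * x₅ * l₅
            ≈⟨ solve 5 (λ b x₁ x₅ l₁ l₅ → b :* x₁ :* l₁ :+ b :* b :* x₅ :* l₅ := b :* (b :* (l₅ :* x₅) :+ l₁ :* x₁)) refl b x₁ x₅ l₁ l₅ ⟩
          b * (b * (l₅ * x₅) + l₁ * x₁) ≈⟨ *-congˡ eq₄ ⟩
          b * (l₄ * (b * x₅ + x₁))
            ≈⟨ solve 4 (λ b x₁ x₅ l₄ → b :* (l₄ :* (b :* x₅ :+ x₁)) := b :* x₁ :* l₄ :+ b :* b :* x₅ :* l₄) refl b x₁ x₅ l₄ ⟩
          y * l₄ + b * b * x₅ * l₄     ≈⟨ +-congˡ (*-congʳ b²x₅≈-x₅) ⟩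
          y * l₄ + - x₅ * l₄           ∎)) (begin
          - x₅ * (l₄ - l₅)     ≈⟨ -‿distribˡ-* x₅ _ ⟨
          - (x₅ * (l₄ - l₅))   ≈⟨ -‿distribʳ-* x₅ _ ⟩
          x₅ * - (l₄ - l₅)     ≈⟨ *-congˡ (⁻¹-anti-homo-// l₄ l₅) ⟩
          x₅ * (l₅ - l₄)       ∎)
          where
          b²x₅≈-x₅ : b * b * x₅ ≈ - x₅
          b²x₅≈-x₅ = trans (*-congʳ (+-inverseˡ-unique _ _ b²+1≈0)) (-1*x≈-x x₅)
        ratio : (l₁ - l₀) * (l₅ - l₄) ≈ (l₀ - l₅) * (l₁ - l₄)
        ratio = *-cancelˡ′ y*x₅≉0 (begin
          y * x₅ * ((l₁ - l₀) * (l₅ - l₄))     ≈⟨ interchange y x₅ _ _ ⟩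
          y * (l₁ - l₀) * (x₅ * (l₅ - l₄))     ≈⟨ *-cong ratio₀ (sym ratio₄) ⟩
          x₅ * (l₀ - l₅) * (y * (l₁ - l₄))     ≈⟨ interchange x₅ _ y _ ⟩
          x₅ * y * ((l₀ - l₅) * (l₁ - l₄))     ≈⟨ *-congʳ (*-comm x₅ y) ⟩
          y * x₅ * ((l₀ - l₅) * (l₁ - l₄))     ∎)
          where open import Algebra.Properties.CommutativeSemigroup *-commutativeSemigroup using (interchange)

-- Linear algebra over a finite field by counting.

distinct⇒1< : ∀ {n} {i j : Fin n} → i ≢ j → 1 ℕ.< n
distinct⇒1< {i = zero}  {zero}          0≢0 = contradiction ≡.refl 0≢0
distinct⇒1< {suc (suc _)}               _   = ℕ.s<s ℕ.z<s

n<m^n : ∀ {m} → 1 ℕ.< m → ∀ n → n ℕ.< m ℕ.^ n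
n<m^n 1<m zero    = ℕ.z<s
n<m^n 1<m (suc n) = ℕ.≤-<-trans (n<m^n 1<m n) (ℕ.^-monoʳ-< _ 1<m (ℕ.n<1+n n))

funToFin-cong : ∀ {m n} {f g : Fin m → Fin n} → (∀ i → f i ≡ g i) → Fin.funToFin f ≡ Fin.funToFin g
funToFin-cong {zero}  f≗g = ≡.refl
funToFin-cong {suc m} f≗g = ≡.cong₂ Fin.combine (f≗g zero) (funToFin-cong (f≗g ∘ suc))

module FiniteLinearAlgebra {c ℓ a m ℓm q} (F : FiniteField c ℓ a q)
  (V : Module (FiniteField.commutativeRing F) m ℓm) where
  open FiniteFieldProperties F
  open CommutativeRing (FiniteField.commutativeRing F) hiding (zero)
  open RingProperties ring
  open Module V
  open Sum +ᴹ-commutativeMonoid using (sum; sum-cong-≋; ∑-distrib-+)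
  open AbelianGroupProperties +ᴹ-abelianGroup using (inverseˡ-unique)
  open import Relation.Binary.Reasoning.Setoid ≈ᴹ-setoid

  lc : ∀ {n} → Vector Carrier n → Vector Carrierᴹ n → Carrierᴹ
  lc = linearCombination V

  -- Together with `code` this numbers the coefficient vectors by Fin (q^n), so that comparing
  -- dimensions becomes comparing finite cardinalities.
  coords : ∀ {n} → Fin (q ℕ.^ n) → Vector Carrier n
  coords i = elem ∘ Fin.finToFun i

  code : ∀ {n} → Vector Carrier n → Fin (q ℕ.^ n)
  code a = Fin.funToFin (index ∘ a)

  coords-code : ∀ {n} (a : Vector Carrier n) i → coords {n} (code a) i ≈ a i
  coords-code {n} a i = trans (reflexive (≡.cong elem (Fin.finToFun-funToFin (index ∘ a) i))) (elem-index (a i))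

  code-injective : ∀ {n} {a b : Vector Carrier n} → code a ≡ code b → ∀ i → a i ≈ b i
  code-injective {n} {a} {b} eq i =
    trans (sym (coords-code a i)) (trans (reflexive (≡.cong (λ j → coords {n} j i) eq)) (coords-code b i))

  coords-injective : ∀ {n} {i j : Fin (q ℕ.^ n)} → (∀ k → coords {n} i k ≈ coords {n} j k) → i ≡ j
  coords-injective {n} {i} {j} eq = ≡.trans (≡.sym (code-coords i)) (≡.trans (funToFin-cong (λ k → index-cong (eq k))) (code-coords j))
    where
    code-coords : ∀ i → code (coords {n} i) ≡ i
    code-coords i = ≡.trans (funToFin-cong {n} (index-elem ∘ Fin.finToFun i)) (Fin.funToFin-finToFin {n} i)

  lc-cong : ∀ {n} {a b : Vector Carrier n} (v : Vector Carrierᴹ n) → (∀ i → a i ≈ b i) → lc a v ≈ᴹ lc b v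
  lc-cong v a≈b = sum-cong-≋ (λ i → *ₗ-congʳ (a≈b i))

  lc-+ : ∀ {n} (a b : Vector Carrier n) v → lc (λ i → a i + b i) v ≈ᴹ lc a v +ᴹ lc b v
  lc-+ a b v = ≈ᴹ-trans (sum-cong-≋ (λ i → *ₗ-distribʳ (v i) (a i) (b i)))
                        (∑-distrib-+ (λ i → a i *ₗ v i) (λ i → b i *ₗ v i))

  lc-* : ∀ {n} k (a : Vector Carrier n) v → lc (λ i → k * a i) v ≈ᴹ k *ₗ lc a v
  lc-* {zero}  k a v = ≈ᴹ-sym (*ₗ-zeroʳ k)
  lc-* {suc n} k a v = ≈ᴹ-trans (+ᴹ-cong (*ₗ-assoc k (a zero) (v zero)) (lc-* k (a ∘ suc) (v ∘ suc)))
                                (≈ᴹ-sym (*ₗ-distribˡ k _ _))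

  independent⇒injective : ∀ {n} {v : Vector Carrierᴹ n} → LinearlyIndependent V v →
                          ∀ {a b} → lc a v ≈ᴹ lc b v → ∀ i → a i ≈ b i
  -- The difference is written with the scalar `- 1#`, so that `lc-+` and `lc-*` apply to it
  -- directly.
  independent⇒injective {v = v} indep {a} {b} eq i = x+-1*y≈0⇒x≈y (indep (λ i → a i + - 1# * b i) (begin
    lc (λ i → a i + - 1# * b i) v         ≈⟨ lc-+ a _ v ⟩
    lc a v +ᴹ lc (λ i → - 1# * b i) v     ≈⟨ +ᴹ-cong eq (lc-* (- 1#) b v) ⟩
    lc b v +ᴹ - 1# *ₗ lc b v              ≈⟨ +ᴹ-congʳ (*ₗ-identityˡ _) ⟨
    1# *ₗ lc b v +ᴹ - 1# *ₗ lc b v        ≈⟨ *ₗ-distribʳ _ 1# (- 1#) ⟨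
    (1# + - 1#) *ₗ lc b v                 ≈⟨ *ₗ-congʳ (-‿inverseʳ 1#) ⟩
    0# *ₗ lc b v                          ≈⟨ *ₗ-zeroˡ _ ⟩
    0ᴹ                                    ∎) i)
    where
    x+-1*y≈0⇒x≈y : ∀ {x y} → x + - 1# * y ≈ 0# → x ≈ y
    x+-1*y≈0⇒x≈y {x} {y} eq =
      RingProperties.x∙y⁻¹≈ε⇒x≈y ring x y (trans (+-congˡ (sym (-1*x≈-x y))) eq)

  1<q : 1 ℕ.< q
  1<q = distinct⇒1< (1≉0 ∘ index-injective)

  module _ {p} {U : Pred Carrierᴹ p} (U-isSubspace : IsSubspace V U) where
    open IsSubspace U-isSubspace

    lc∈ : ∀ {n} a (v : Vector Carrierᴹ n) → (∀ i → v i ∈ U) → lc a v ∈ U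
    lc∈ {zero}  a v v∈U = 0ᴹ-closed
    lc∈ {suc n} a v v∈U = +ᴹ-closed (*ₗ-closed (a zero) (v∈U zero)) (lc∈ (a ∘ suc) (v ∘ suc) (v∈U ∘ suc))

  module _ {p} {U : Pred Carrierᴹ p} (U-isSubspace : IsSubspace V U)
           {N} (g : Fin N → Carrierᴹ) (position : ∀ {u} → u ∈ U → ∃[ i ] u ≈ᴹ g i) where

    -- All q^n combinations lie in U and are distinct. Their positions in the list are therefore
    -- distinct too, even if the list has repetitions.
    independent⇒q^n≤N : ∀ {n} (v : Vector Carrierᴹ n) → (∀ i → v i ∈ U) → LinearlyIndependent V v → q ℕ.^ n ℕ.≤ N
    independent⇒q^n≤N {n} v v∈U indep = Fin.injective⇒≤ {f = λ j → proj₁ (pos j)} λ {i} {j} eq →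
      coords-injective {n} (independent⇒injective indep
        (≈ᴹ-trans (proj₂ (pos i)) (≈ᴹ-trans (≈ᴹ-reflexive (≡.cong g eq)) (≈ᴹ-sym (proj₂ (pos j))))))
      where
      pos : ∀ j → ∃[ i ] lc (coords {n} j) v ≈ᴹ g i
      pos j = position (lc∈ U-isSubspace (coords {n} j) v v∈U)

    module _ (g∈U : ∀ i → g i ∈ U) where

      -- Each listed vector is determined by the code of its coordinates.
      spanning⇒N≤q^n : (∀ {i j} → g i ≈ᴹ g j → i ≡ j) →
                       ∀ {n} {v : Vector Carrierᴹ n} → IsBasis V U v → N ℕ.≤ q ℕ.^ n
      spanning⇒N≤q^n g-inj {v = v} basis = Fin.injective⇒≤ {f = λ i → code (proj₁ (span i))} λ {i} {j} eq →
        g-inj (≈ᴹ-trans (proj₂ (span i)) (≈ᴹ-trans (lc-cong v (code-injective eq)) (≈ᴹ-sym (proj₂ (span j)))))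
        where
        span : ∀ i → ∃[ a ] g i ≈ᴹ lc a v
        span i = IsBasis.spanning basis (g∈U i)

      module _ (_≟ᴹ_ : ∀ u v → Dec (u ≈ᴹ v)) where

        inSpan? : ∀ {n} (v : Vector Carrierᴹ n) u → Dec (∃[ a ] u ≈ᴹ lc a v)
        inSpan? {n} v u = map′ (λ (i , eq) → coords {n} i , eq)
          (λ (a , eq) → code a , ≈ᴹ-trans eq (lc-cong v (sym ∘ coords-code a)))
          (Fin.any? (λ i → u ≟ᴹ lc (coords {n} i) v))

        extend-independent : ∀ {n} {v : Vector Carrierᴹ n} {u} → LinearlyIndependent V v →
          ¬ (∃[ a ] u ≈ᴹ lc a v) → LinearlyIndependent V (u Vector.∷ v)
        extend-independent {v = v} {u} indep u∉span a eq with a zero ≟ 0#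
        ... | yes a₀≈0 = λ { zero → a₀≈0 ; (suc i) → indep (a ∘ suc) (begin
          lc (a ∘ suc) v                  ≈⟨ +ᴹ-identityˡ _ ⟨
          0ᴹ +ᴹ lc (a ∘ suc) v            ≈⟨ +ᴹ-congʳ (≈ᴹ-trans (*ₗ-congʳ a₀≈0) (*ₗ-zeroˡ u)) ⟨
          a zero *ₗ u +ᴹ lc (a ∘ suc) v   ≈⟨ eq ⟩
          0ᴹ                              ∎) i }
        ... | no a₀≉0 = contradiction ((λ i → - a₀⁻¹ * a (suc i)) , (begin
          u                               ≈⟨ inverseˡ-unique u _ a₀⁻¹eq ⟩
          -ᴹ (a₀⁻¹ *ₗ lc (a ∘ suc) v)     ≈⟨ inverseˡ-unique _ _ -+≈0 ⟨
          - a₀⁻¹ *ₗ lc (a ∘ suc) v        ≈⟨ lc-* (- a₀⁻¹) (a ∘ suc) v ⟨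
          lc (λ i → - a₀⁻¹ * a (suc i)) v ∎)) u∉span
          where
          a₀⁻¹ = proj₁ (inverse a₀≉0)
          -+≈0 : - a₀⁻¹ *ₗ lc (a ∘ suc) v +ᴹ a₀⁻¹ *ₗ lc (a ∘ suc) v ≈ᴹ 0ᴹ
          -+≈0 = ≈ᴹ-trans (≈ᴹ-sym (*ₗ-distribʳ _ (- a₀⁻¹) a₀⁻¹)) (≈ᴹ-trans (*ₗ-congʳ (-‿inverseˡ a₀⁻¹)) (*ₗ-zeroˡ _))
          a₀⁻¹eq : u +ᴹ a₀⁻¹ *ₗ lc (a ∘ suc) v ≈ᴹ 0ᴹ
          a₀⁻¹eq = begin
            u +ᴹ a₀⁻¹ *ₗ lc (a ∘ suc) v
              ≈⟨ +ᴹ-congʳ (≈ᴹ-trans (*ₗ-congʳ (proj₂ (inverse a₀≉0))) (*ₗ-identityˡ u)) ⟨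
            (a₀⁻¹ * a zero) *ₗ u +ᴹ a₀⁻¹ *ₗ lc (a ∘ suc) v
              ≈⟨ +ᴹ-congʳ (*ₗ-assoc a₀⁻¹ (a zero) u) ⟩
            a₀⁻¹ *ₗ (a zero *ₗ u) +ᴹ a₀⁻¹ *ₗ lc (a ∘ suc) v
              ≈⟨ *ₗ-distribˡ a₀⁻¹ _ _ ⟨
            a₀⁻¹ *ₗ (a zero *ₗ u +ᴹ lc (a ∘ suc) v)
              ≈⟨ ≈ᴹ-trans (*ₗ-congˡ eq) (*ₗ-zeroʳ a₀⁻¹) ⟩
            0ᴹ ∎

        -- Greedy extension by listed vectors outside the current span. The number of rounds is
        -- bounded by the crude estimate n < q^n ≤ N for n independent vectors.
        hasDimension : ∃[ n ] HasDimension V U n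
        hasDimension = grow N (ℕ.+-identityʳ N) (λ ()) (λ ()) (λ _ _ ())
          where
          grow : ∀ k {n} → k ℕ.+ n ≡ N → (v : Vector Carrierᴹ n) → (∀ i → v i ∈ U) → LinearlyIndependent V v →
                 ∃[ n ] HasDimension V U n
          grow k {n} k+n≡N v v∈U indep with Fin.all? (inSpan? v ∘ g)
          ... | yes spans = n , v , record
            { members     = v∈U
            ; independent = indep
            ; spanning    = λ u∈U → let (i , u≈gᵢ) = position u∈U; (a , gᵢ≈lc) = spans i in
                                    a , ≈ᴹ-trans u≈gᵢ gᵢ≈lc
            }
          ... | no ¬spans with i , gᵢ∉span ← Fin.¬∀⟶∃¬ N _ (inSpan? v ∘ g) ¬spans = step k k+n≡N
            where
            w : Vector Carrierᴹ (suc n)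
            w = g i Vector.∷ v
            w∈U : ∀ j → w j ∈ U
            w∈U = λ { zero → g∈U i ; (suc j) → v∈U j }
            w-indep : LinearlyIndependent V w
            w-indep = extend-independent indep gᵢ∉span
            step : ∀ k → k ℕ.+ n ≡ N → ∃[ n ] HasDimension V U n
            -- When the fuel is used up, n = N; one more independent vector would give n + 1 <
            -- q^(n+1) ≤ N = n.
            step zero    n≡N   = contradiction (ℕ.<-≤-trans (n<m^n 1<q (suc n)) (independent⇒q^n≤N w w∈U w-indep))
                                   (ℕ.≤⇒≯ (ℕ.≤-trans (ℕ.≤-reflexive (≡.sym n≡N)) (ℕ.n≤1+n n)))
            step (suc k) k+n≡N = grow k (≡.trans (ℕ.+-suc k n) k+n≡N) w w∈U w-indep

-- The subfield F_q as the fixed points of x ↦ x^q.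

odd : ∀ {n} → 2 ∤ n → ∃[ h ] n ≡ 1 ℕ.+ h ℕ.* 2
odd {n} 2∤n with n ℕ.% 2 | m≡m%n+[m/n]*n n 2 | m%n<n n 2 | m%n≡0⇒n∣m n 2
... | zero        | _  | _                     | 0⇒2∣n = contradiction (0⇒2∣n ≡.refl) 2∤n
... | suc zero    | eq | _                     | _     = n ℕ./ 2 , eq
... | suc (suc _) | _  | ℕ.s<s (ℕ.s<s ())      | _

module SubfieldExtension {c₁ ℓ₁ a₁ c₂ ℓ₂ a₂ : Level} (q m : ℕ) (q-pp : IsPrimePower q)
  (K : FiniteField c₁ ℓ₁ a₁ q) (L : FiniteField c₂ ℓ₂ a₂ (q ℕ.^ m))
  (φ : RingHomomorphism (CommutativeRing.rawRing (FiniteField.commutativeRing K))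
                        (CommutativeRing.rawRing (FiniteField.commutativeRing L)))
  where
  private
    module K = CommutativeRing (FiniteField.commutativeRing K)
    module KF = FiniteFieldProperties K
    module KE = Exp K.commutativeSemiring
  open CommutativeRing (FiniteField.commutativeRing L) hiding (zero)
  open RingProperties ring
  open FiniteFieldProperties L
  open Exp commutativeSemiring
  open Mult semiring using (×-assocˡ; ×-congʳ) renaming (_×_ to _•_)
  open RingHomomorphism φ using (⟦_⟧; ⟦⟧-cong; +-homo; *-homo; 0#-homo; 1#-homo)
  open MonicPolynomial (FiniteField.commutativeRing L) using (eval; ¬degree+1-roots)
  open import Relation.Binary.Reasoning.Setoid setoid

  private
    p = proj₁ q-pp
    k = proj₁ (proj₂ q-pp)
    p-prime = proj₁ (proj₂ (proj₂ q-pp))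
    1≤k = proj₁ (proj₂ (proj₂ (proj₂ q-pp)))
    q≡p^k = proj₂ (proj₂ (proj₂ (proj₂ q-pp)))

  q^n≡p^kn : ∀ n → q ℕ.^ n ≡ p ℕ.^ (k ℕ.* n)
  q^n≡p^kn n = ≡.trans (≡.cong (ℕ._^ n) q≡p^k) (ℕ.^-*-assoc p k n)

  p•1≈0 : p • 1# ≈ 0#
  p•1≈0 = characteristic (k ℕ.* m) (q^n≡p^kn m)

  open PrimeCharacteristic (FiniteField.commutativeRing L)

  ^qⁿ-+ : ∀ n x y → (x + y) ^ (q ℕ.^ n) ≈ x ^ (q ℕ.^ n) + y ^ (q ℕ.^ n)
  ^qⁿ-+ n x y rewrite q^n≡p^kn n = ^pᵏ-+ p-prime p•1≈0 (k ℕ.* n) x y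

  ^q-+ : ∀ x y → (x + y) ^ q ≈ x ^ q + y ^ q
  ^q-+ x y = ≡.subst (λ r → (x + y) ^ r ≈ x ^ r + y ^ r) (ℕ.^-identityʳ q) (^qⁿ-+ 1 x y)

  -- If 2 = 0, then writing q = 1 + 2h gives q·1 = 1, whereas p divides q and so q·1 = 0.
  2≉0 : 2 ∤ q → ¬ 1# + 1# ≈ 0#
  2≉0 2∤q 2≈0 with h , q≡1+2h ← odd 2∤q = 1≉0 (begin
    1#                       ≈⟨ trans (+-congˡ h2≈0) (+-identityʳ 1#) ⟨
    1# + (h ℕ.* 2) • 1#      ≡⟨ ≡.cong (_• 1#) q≡1+2h ⟨
    q • 1#                   ≈⟨ multiple•≈0 p-prime p•1≈0 p∣q 1# ⟩
    0#                       ∎)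
    where
    p∣q : p ∣ q
    p∣q = ≡.subst (p ∣_) (≡.sym q≡p^k) (p∣p^ 1≤k)
      where
      p∣p^ : ∀ {j} → 1 ℕ.≤ j → p ∣ p ℕ.^ j
      p∣p^ {suc j} _ = m∣m*n (p ℕ.^ j)
    h2≈0 : (h ℕ.* 2) • 1# ≈ 0#
    h2≈0 = trans (sym (×-assocˡ 1# h 2)) (trans (×-congʳ h (trans (+-congˡ (+-identityʳ 1#)) 2≈0)) (n•0≈0 h))

  ⟦a^n⟧ : ∀ a n → ⟦ a KE.^ n ⟧ ≈ ⟦ a ⟧ ^ n
  ⟦a^n⟧ a zero    = 1#-homo
  ⟦a^n⟧ a (suc n) = trans (*-homo a (a KE.^ n)) (*-congˡ (⟦a^n⟧ a n))

  a^qⁿ≈a : ∀ n a → a KE.^ (q ℕ.^ n) K.≈ a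
  a^qⁿ≈a zero    a = K.*-identityʳ a
  a^qⁿ≈a (suc n) a = K.trans (K.sym (KE.^-assocʳ a q (q ℕ.^ n)))
                      (K.trans (KE.^-congˡ (q ℕ.^ n) (KF.x^n≈x a)) (a^qⁿ≈a n a))

  ⟦a⟧^qⁿ≈⟦a⟧ : ∀ n a → ⟦ a ⟧ ^ (q ℕ.^ n) ≈ ⟦ a ⟧
  ⟦a⟧^qⁿ≈⟦a⟧ n a = trans (sym (⟦a^n⟧ a (q ℕ.^ n))) (⟦⟧-cong (a^qⁿ≈a n a))

  ⟦a⟧^q≈⟦a⟧ : ∀ a → ⟦ a ⟧ ^ q ≈ ⟦ a ⟧
  ⟦a⟧^q≈⟦a⟧ a = trans (sym (⟦a^n⟧ a q)) (⟦⟧-cong (KF.x^n≈x a))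

  ⟦a⟧≈0⇒a≈0 : ∀ {a} → ⟦ a ⟧ ≈ 0# → a K.≈ K.0#
  ⟦a⟧≈0⇒a≈0 {a} ⟦a⟧≈0 with a KF.≟ K.0#
  ... | yes a≈0 = a≈0
  ... | no  a≉0 with a⁻¹ , a⁻¹a≈1 ← KF.inverse a≉0 = contradiction (begin
    1#                  ≈⟨ 1#-homo ⟨
    ⟦ K.1# ⟧            ≈⟨ ⟦⟧-cong a⁻¹a≈1 ⟨
    ⟦ a⁻¹ K.* a ⟧       ≈⟨ *-homo a⁻¹ a ⟩
    ⟦ a⁻¹ ⟧ * ⟦ a ⟧     ≈⟨ trans (*-congˡ ⟦a⟧≈0) (zeroʳ _) ⟩
    0#                  ∎) 1≉0

  ⟦⟧-injective : ∀ {a b} → ⟦ a ⟧ ≈ ⟦ b ⟧ → a K.≈ b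
  ⟦⟧-injective {a} {b} eq = RingProperties.x∙y⁻¹≈ε⇒x≈y K.ring a b (⟦a⟧≈0⇒a≈0 (begin
    ⟦ a K.- b ⟧              ≈⟨ +-homo a (K.- b) ⟩
    ⟦ a ⟧ + ⟦ K.- b ⟧        ≈⟨ +-congʳ eq ⟩
    ⟦ b ⟧ + ⟦ K.- b ⟧        ≈⟨ +-homo b (K.- b) ⟨
    ⟦ b K.- b ⟧              ≈⟨ ⟦⟧-cong (K.-‿inverseʳ b) ⟩
    ⟦ K.0# ⟧                 ≈⟨ 0#-homo ⟩
    0#                       ∎))

  -- The monic polynomial X^r - X. The bound on r keeps its linear coefficient -1 apart from the
  -- implicit leading 1.
  xʳ-x : ∀ {r} → 1 ℕ.< r → ∃ λ (cs : Vec Carrier r) → ∀ x → eval cs x + x ≈ x ^ r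
  xʳ-x {suc (suc j)} (ℕ.s<s _) = 0# ∷ - 1# ∷ Vec.replicate j 0# , λ x → begin
    0# + x * (- 1# + x * eval (Vec.replicate j 0#) x) + x
      ≈⟨ +-cong (+-identityˡ _) (sym (*-identityʳ x)) ⟩
    x * (- 1# + x * eval (Vec.replicate j 0#) x) + x * 1#
      ≈⟨ distribˡ x _ _ ⟨
    x * (- 1# + x * eval (Vec.replicate j 0#) x + 1#)
      ≈⟨ *-congˡ (trans (+-congʳ (+-comm _ _)) (trans (+-assoc _ _ _) (trans (+-congˡ (-‿inverseˡ 1#)) (+-identityʳ _)))) ⟩
    x * (x * eval (Vec.replicate j 0#) x)
      ≈⟨ *-congˡ (*-congˡ (eval-zeros j x)) ⟩
    x * (x * x ^ j) ∎
    where
    eval-zeros : ∀ j x → eval (Vec.replicate j 0#) x ≈ x ^ j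
    eval-zeros zero    x = refl
    eval-zeros (suc j) x = trans (+-identityˡ _) (*-congˡ (eval-zeros j x))

  -- Otherwise x and the q images of K would be q + 1 distinct roots of X^q - X.
  x^q≈x⇒x∈K : ∀ {x} → x ^ q ≈ x → ∃[ a ] x ≈ ⟦ a ⟧
  x^q≈x⇒x∈K {x} x^q≈x with Fin.any? (λ i → x ≟ ⟦ KF.elem i ⟧)
  ... | yes (i , x≈⟦eᵢ⟧) = KF.elem i , x≈⟦eᵢ⟧
  ... | no  x∉K = contradiction (λ i → root i (fixed i))
                    (¬degree+1-roots xy≈0⇒x≈0∨y≈0 1≉0 (proj₁ poly) r (λ {i} {j} → r-inj i j))
    where
    poly = xʳ-x (distinct⇒1< (KF.1≉0 ∘ KF.index-injective))
    r : Vector Carrier (suc q)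
    r = x Vector.∷ (⟦_⟧ ∘ KF.elem)
    r-inj : ∀ i j → r i ≈ r j → i ≡ j
    r-inj zero    zero    _  = ≡.refl
    r-inj zero    (suc j) eq = contradiction (j , eq) x∉K
    r-inj (suc i) zero    eq = contradiction (i , sym eq) x∉K
    r-inj (suc i) (suc j) eq = ≡.cong suc
      (≡.trans (≡.sym (KF.index-elem i)) (≡.trans (KF.index-cong (⟦⟧-injective eq)) (KF.index-elem j)))
    fixed : ∀ i → r i ^ q ≈ r i
    fixed zero    = x^q≈x
    fixed (suc i) = ⟦a⟧^q≈⟦a⟧ (KF.elem i)
    root : ∀ i → r i ^ q ≈ r i → eval (proj₁ poly) (r i) ≈ 0#
    root i eq = +-cancelʳ (r i) _ _ (trans (proj₂ poly (r i)) (trans eq (sym (+-identityˡ _))))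

-- The upper bound for the dimension of a scattered subspace.

module ScatteredBound {c₁ ℓ₁ a₁ c₂ ℓ₂ a₂ : Level} (q m : ℕ)
  (K : FiniteField c₁ ℓ₁ a₁ q) (L : FiniteField c₂ ℓ₂ a₂ (q ℕ.^ m))
  (φ : RingHomomorphism (CommutativeRing.rawRing (FiniteField.commutativeRing K))
                        (CommutativeRing.rawRing (FiniteField.commutativeRing L)))
  where
  open FieldExtension q m K L φ
  private
    module K = CommutativeRing (FiniteField.commutativeRing K)
    module KF = FiniteFieldProperties K
    module L = CommutativeRing (FiniteField.commutativeRing L)
    module V = Module L²∣K
    module LA = FiniteLinearAlgebra K L²∣K
  open FiniteFieldProperties L
  open LA using (lc)

  lc-unit : ∀ {n} (v : Vector Carrierᴹ n) → LinearlyIndependent L²∣K v →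
            ∀ (a : Vector K.Carrier n) i → a i K.≈ K.1# → ¬ lc a v ≈ᴹ 0ᴹ
  lc-unit v indep a i aᵢ≈1 lc≈0 = KF.1≉0 (K.trans (K.sym aᵢ≈1) (indep a lc≈0 i))

  -- Representatives of the points of the projective line over L: the point at infinity, then the
  -- affine ones by slope.
  direction : Fin (suc (q ℕ.^ m)) → Carrierᴹ
  direction zero    = 0# , 1#
  direction (suc i) = 1# , elem i

  direction≉0 : ∀ i → direction i ≉ᴹ 0ᴹ
  direction≉0 zero    (_ , 1≈0) = 1≉0 1≈0
  direction≉0 (suc i) (1≈0 , _) = 1≉0 1≈0

  point : ∀ w → ∃[ i ] w ∈ ⟨ L² ⟩ (direction i)
  point (x , y) with x ≟ 0#
  ... | yes x≈0 = zero , y , L.trans x≈0 (L.sym (L.zeroʳ y)) , L.sym (L.*-identityʳ y)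
  ... | no  x≉0 with x⁻¹ , x⁻¹x≈1 ← inverse x≉0 = suc (index (x⁻¹ * y)) , x , L.sym (L.*-identityʳ x) ,
    L.sym (L.trans (L.*-congˡ (elem-index (x⁻¹ * y)))
      (L.trans (L.sym (L.*-assoc x x⁻¹ y)) (L.trans (L.*-congʳ (L.trans (L.*-comm x x⁻¹) x⁻¹x≈1)) (L.*-identityˡ y))))

  module _ {w} {W : Pred Carrierᴹ w} (W-scattered : IsScattered W) where
    open IsScattered W-scattered

    -- Both vectors are K-multiples of the single basis vector of the intersection; multiplying each
    -- by the coefficient of the other makes them agree. Dimension 0 is impossible, as `u` is a
    -- nonzero member.
    collinear⇒proportional : ∀ {v u u′} → v ≉ᴹ 0ᴹ → u ∈ ⟨ L² ⟩ v → u′ ∈ ⟨ L² ⟩ v → u ∈ W → u′ ∈ W →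
      u ≉ᴹ 0ᴹ → u′ ≉ᴹ 0ᴹ → ∃[ k ] ∃[ k′ ] ¬ k K.≈ K.0# × ¬ k′ K.≈ K.0# × k′ V.*ₗ u ≈ᴹ k V.*ₗ u′
    collinear⇒proportional {v} {u} {u′} v≉0 u∈⟨v⟩ u′∈⟨v⟩ u∈W u′∈W u≉0 u′≉0 = go (dim≤1 v v≉0)
      where
      go : (∃[ d ] HasDimension L²∣K (⟨ L² ⟩ v ∩ W) d × d ℕ.≤ 1) →
           ∃[ k ] ∃[ k′ ] ¬ k K.≈ K.0# × ¬ k′ K.≈ K.0# × k′ V.*ₗ u ≈ᴹ k V.*ₗ u′
      go (zero , (e , basis) , _) = contradiction (proj₂ (IsBasis.spanning basis (u∈⟨v⟩ , u∈W))) u≉0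
      go (suc zero , (e , basis) , _)
        with a , u≈ae ← IsBasis.spanning basis (u∈⟨v⟩ , u∈W)
           | a′ , u′≈a′e ← IsBasis.spanning basis (u′∈⟨v⟩ , u′∈W) =
        a zero , a′ zero , coefficient≉0 a u≈ae u≉0 , coefficient≉0 a′ u′≈a′e u′≉0 , (begin
          a′ zero V.*ₗ u                          ≈⟨ V.*ₗ-congˡ u≈ae ⟩
          a′ zero V.*ₗ lc a e                     ≈⟨ V.*ₗ-congˡ (V.+ᴹ-identityʳ _) ⟩
          a′ zero V.*ₗ (a zero V.*ₗ e zero)       ≈⟨ V.*ₗ-assoc _ _ _ ⟨
          (a′ zero K.* a zero) V.*ₗ e zero        ≈⟨ V.*ₗ-congʳ (K.*-comm _ _) ⟩
          (a zero K.* a′ zero) V.*ₗ e zero        ≈⟨ V.*ₗ-assoc _ _ _ ⟩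
          a zero V.*ₗ (a′ zero V.*ₗ e zero)       ≈⟨ V.*ₗ-congˡ (V.+ᴹ-identityʳ _) ⟨
          a zero V.*ₗ lc a′ e                     ≈⟨ V.*ₗ-congˡ u′≈a′e ⟨
          a zero V.*ₗ u′                          ∎)
        where
        open import Relation.Binary.Reasoning.Setoid V.≈ᴹ-setoid
        coefficient≉0 : ∀ a {u} → u ≈ᴹ lc a e → u ≉ᴹ 0ᴹ → ¬ a zero K.≈ K.0#
        coefficient≉0 a u≈ae u≉0 a₀≈0 = u≉0 (V.≈ᴹ-trans u≈ae (V.≈ᴹ-trans (V.+ᴹ-identityʳ _)
          (V.≈ᴹ-trans (V.*ₗ-congʳ a₀≈0) (V.*ₗ-zeroˡ (e zero)))))
      go (suc (suc _) , _ , ℕ.s≤s ())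

    -- The |L| combinations with leading coefficient 1 and two further basis vectors are pairwise
    -- non-proportional, hence too many for the |L| + 1 lines of L².
    scattered⇒dim≤m : ∀ {j₁ j₂ : Fin m} → j₁ ≢ j₂ → ∀ {d} → HasDimension L²∣K W d → d ℕ.≤ m
    scattered⇒dim≤m {j₁} {j₂} j₁≢j₂ {d} W-dim = ℕ.≮⇒≥ λ m<d →
      let k , 1+m+k≡d = ℕ.m≤n⇒∃[o]m+o≡n m<d in
      absurd k (≡.subst (HasDimension L²∣K W) (≡.sym 1+m+k≡d) W-dim)
      where
      module _ (k : ℕ) where
        unit : ∀ {n} → Fin n → Vector K.Carrier n
        unit j i = if does (i Fin.≟ j) then K.1# else K.0#

        unit-same : ∀ {n} (j : Fin n) → unit j j K.≈ K.1#
        unit-same j rewrite dec-true (j Fin.≟ j) ≡.refl = K.refl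

        unit-other : ∀ {n} {i j : Fin n} → i ≢ j → unit j i K.≈ K.0#
        unit-other {i = i} {j} i≢j rewrite dec-false (i Fin.≟ j) i≢j = K.refl

        position : Fin m → Fin (suc (m ℕ.+ k))
        position j = suc (j Fin.↑ˡ k)

        coefficients : Fin (2 ℕ.+ q ℕ.^ m) → Vector K.Carrier (suc (m ℕ.+ k))
        coefficients zero          = unit (position j₁)
        coefficients (suc zero)    = unit (position j₂)
        -- The first m + 1 coordinates suffice to separate the vectors; the k surplus ones are set
        -- to zero.
        coefficients (suc (suc i)) = K.1# Vector.∷ (LA.coords {m} i Vector.++ Vector.replicate k K.0#)

        leading : ∀ i → Fin (suc (m ℕ.+ k))
        leading zero          = position j₁
        leading (suc zero)    = position j₂
        leading (suc (suc _)) = zero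

        leading≈1 : ∀ i → coefficients i (leading i) K.≈ K.1#
        leading≈1 zero          = unit-same (position j₁)
        leading≈1 (suc zero)    = unit-same (position j₂)
        leading≈1 (suc (suc _)) = K.refl

        x*1≈y*0⇒x≈0 : ∀ {x y u v} → x K.* u K.≈ y K.* v → u K.≈ K.1# → v K.≈ K.0# → x K.≈ K.0#
        x*1≈y*0⇒x≈0 {x} {y} {u} {v} xu≈yv u≈1 v≈0 = begin
          x           ≈⟨ K.*-identityʳ x ⟨
          x K.* K.1#  ≈⟨ K.*-congˡ u≈1 ⟨
          x K.* u     ≈⟨ xu≈yv ⟩
          y K.* v     ≈⟨ K.*-congˡ v≈0 ⟩
          y K.* K.0#  ≈⟨ K.zeroʳ y ⟩
          K.0#        ∎
          where open import Relation.Binary.Reasoning.Setoid K.setoid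

        -- Coordinate 0 decides the cases with a normalised vector: against a unit vector it forces
        -- c = 0, and between two normalised vectors it forces c′ = c, after which all digits agree.
        -- The two unit vectors are separated by the coordinate of `j₁`.
        nonproportional : ∀ {i j} → i Fin.< j → ∀ {c c′} → ¬ c K.≈ K.0# → ¬ c′ K.≈ K.0# →
          ¬ (∀ l → c′ K.* coefficients i l K.≈ c K.* coefficients j l)
        nonproportional {zero} {suc zero} _ {c} {c′} c≉0 c′≉0 eq = c′≉0
          (x*1≈y*0⇒x≈0 (eq (position j₁)) (unit-same (position j₁))
            (unit-other (j₁≢j₂ ∘ Fin.↑ˡ-injective k _ _ ∘ Fin.suc-injective)))
        nonproportional {zero} {suc (suc j)} _ c≉0 c′≉0 eq = c≉0
          (x*1≈y*0⇒x≈0 (K.sym (eq zero)) K.refl K.refl)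
        nonproportional {suc zero} {suc (suc j)} _ c≉0 c′≉0 eq = c≉0
          (x*1≈y*0⇒x≈0 (K.sym (eq zero)) K.refl K.refl)
        nonproportional {suc zero} {suc zero} (ℕ.s<s ())
        nonproportional {suc (suc _)} {suc zero} (ℕ.s<s ())
        nonproportional {suc (suc i)} {suc (suc j)} i<j {c} {c′} c≉0 c′≉0 eq = contradiction
          (≡.cong (Fin.suc ∘ Fin.suc) (LA.coords-injective {m} same)) (Fin.<⇒≢ i<j)
          where
          c′≈c : c′ K.≈ c
          c′≈c = K.trans (K.sym (K.*-identityʳ c′)) (K.trans (eq zero) (K.*-identityʳ c))
          ++-left : ∀ i l → (LA.coords {m} i Vector.++ Vector.replicate k K.0#) (l Fin.↑ˡ k) ≡ LA.coords {m} i l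
          ++-left i l rewrite Fin.splitAt-↑ˡ m l k = ≡.refl
          same : ∀ l → LA.coords {m} i l K.≈ LA.coords {m} j l
          same l = KF.*-cancelˡ-≉0 c≉0 (begin
            c K.* LA.coords {m} i l                ≈⟨ K.*-congʳ c′≈c ⟨
            c′ K.* LA.coords {m} i l               ≡⟨ ≡.cong (c′ K.*_) (++-left i l) ⟨
            c′ K.* coefficients (suc (suc i)) (position l)  ≈⟨ eq (position l) ⟩
            c K.* coefficients (suc (suc j)) (position l)   ≡⟨ ≡.cong (c K.*_) (++-left j l) ⟩
            c K.* LA.coords {m} j l                ∎)
            where open import Relation.Binary.Reasoning.Setoid K.setoid

        absurd : ¬ HasDimension L²∣K W (suc (m ℕ.+ k))
        absurd (v , basis) = nonproportional i<j c≉0 c′≉0 (LA.independent⇒injective {v = v} independent (begin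
          lc (λ l → c′ K.* coefficients i l) v  ≈⟨ LA.lc-* c′ (coefficients i) v ⟩
          c′ V.*ₗ vector i                      ≈⟨ c′u≈cu′ ⟩
          c V.*ₗ vector j                       ≈⟨ LA.lc-* c (coefficients j) v ⟨
          lc (λ l → c K.* coefficients j l) v   ∎))
          where
          open import Relation.Binary.Reasoning.Setoid V.≈ᴹ-setoid
          open IsBasis basis
          vector : Fin (2 ℕ.+ q ℕ.^ m) → Carrierᴹ
          vector i = lc (coefficients i) v
          vector∈W : ∀ i → vector i ∈ W
          vector∈W i = LA.lc∈ isSubspace (coefficients i) v members
          vector≉0 : ∀ i → vector i ≉ᴹ 0ᴹ
          vector≉0 i = lc-unit v independent (coefficients i) (leading i) (leading≈1 i)
          collision = Fin.pigeonhole (ℕ.n<1+n (suc (q ℕ.^ m))) (proj₁ ∘ point ∘ vector)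
          i = proj₁ collision
          j = proj₁ (proj₂ collision)
          i<j = proj₁ (proj₂ (proj₂ collision))
          same-point = proj₂ (proj₂ (proj₂ collision))
          proportional = collinear⇒proportional (direction≉0 (proj₁ (point (vector j))))
            (≡.subst (λ t → vector i ∈ ⟨ L² ⟩ (direction t)) same-point (proj₂ (point (vector i))))
            (proj₂ (point (vector j))) (vector∈W i) (vector∈W j) (vector≉0 i) (vector≉0 j)
          c = proj₁ proportional
          c′ = proj₁ (proj₂ proportional)
          c≉0 = proj₁ (proj₂ (proj₂ proportional))
          c′≉0 = proj₁ (proj₂ (proj₂ (proj₂ proportional)))
          c′u≈cu′ = proj₂ (proj₂ (proj₂ (proj₂ proportional)))

-- The subspace U_{b,1}: scatteredness, dimension, maximality.

module BinomialSubspace {c₁ ℓ₁ a₁ c₂ ℓ₂ a₂ : Level} (q : ℕ) (q-pp : IsPrimePower q) (2∤q : 2 ∤ q)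
  (K : FiniteField c₁ ℓ₁ a₁ q) (L : FiniteField c₂ ℓ₂ a₂ (q ℕ.^ 8))
  (φ : RingHomomorphism (CommutativeRing.rawRing (FiniteField.commutativeRing K))
                        (CommutativeRing.rawRing (FiniteField.commutativeRing L)))
  where
  open FieldExtension q 8 K L φ
  private
    module V = Module L²∣K
    module LA = FiniteLinearAlgebra K L²∣K
  open CommutativeRing (FiniteField.commutativeRing L) hiding (Carrier; _≈_; _≉_; _+_; _*_; -_; 0#; 1#; semiring; zero)
  open RingProperties (CommutativeRing.ring (FiniteField.commutativeRing L))
  open FiniteFieldProperties L
  open SubfieldExtension q 8 q-pp K L φ
  open Exp commutativeSemiring hiding (_^_)
  open RingHomomorphism φ using (⟦_⟧)
  open import Relation.Binary.Reasoning.Setoid setoid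

  σ : Carrier → Carrier
  σ x = x ^ q

  open CyclicExtension (FiniteField.commutativeRing L)
  open Conjugates xy≈0⇒x≈0∨y≈0 (2≉0 2∤q)
    σ (^-congˡ q) ^q-+ (λ x y → ^-distrib-* x y q)

  σ^ : ℕ → Carrier → Carrier
  σ^ zero    x = x
  σ^ (suc n) x = σ^ n (σ x)

  x^qⁿ≈σⁿx : ∀ n x → x ^ (q ℕ.^ n) ≈ σ^ n x
  x^qⁿ≈σⁿx zero    x = *-identityʳ x
  x^qⁿ≈σⁿx (suc n) x = trans (sym (^-assocʳ x q (q ℕ.^ n))) (x^qⁿ≈σⁿx n (σ x))

  σ⁸ : ∀ x → σ⁴ (σ⁴ x) ≈ x
  σ⁸ x = trans (sym (x^qⁿ≈σⁿx 8 x)) (x^n≈x x)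

  module _ (b : Carrier) (b≉0 : b ≉ 0#) (b²≈-1 : b ^ 2 ≈ - 1#) where

    b²+1≈0 : b * b + 1# ≈ 0#
    b²+1≈0 = begin
      b * b + 1#          ≈⟨ +-congʳ (*-congˡ (*-identityʳ b)) ⟨
      b * (b * 1#) + 1#   ≈⟨ +-congʳ b²≈-1 ⟩
      - 1# + 1#           ≈⟨ -‿inverseˡ 1# ⟩
      0#                  ∎

    1^n≈1 : ∀ n → 1# ^ n ≈ 1#
    1^n≈1 zero    = refl
    1^n≈1 (suc n) = trans (*-identityˡ _) (1^n≈1 n)

    σb²+1≈0 : σ b * σ b + 1# ≈ 0#
    σb²+1≈0 = begin
      σ b * σ b + 1#        ≈⟨ +-cong (^-distrib-* b b q) (1^n≈1 q) ⟨
      σ (b * b) + σ 1#      ≈⟨ ^q-+ (b * b) 1# ⟨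
      σ (b * b + 1#)        ≈⟨ ^-congˡ q b²+1≈0 ⟩
      σ 0#                  ≈⟨ σ-0 ⟩
      0#                    ∎

    -- Both σ(b) and b are square roots of -1, so (σ(b) - b)(σ(b) + b) = 0.
    σb≈±b : σ b ≈ b ⊎ σ b ≈ - b
    σb≈±b = crossed (begin
      σ b * σ b + b * - b       ≈⟨ +-cong (+-cancelʳ 1# _ _ (trans σb²+1≈0 (sym b²+1≈0))) (sym (-‿distribʳ-* b b)) ⟩
      b * b - b * b             ≈⟨ -‿inverseʳ _ ⟩
      0#                        ≈⟨ -‿inverseˡ _ ⟨
      - (σ b * b) + σ b * b     ≈⟨ +-cong (-‿distribʳ-* (σ b) b) (*-comm (σ b) b) ⟩
      σ b * - b + b * σ b       ∎)

    σ²b≈b : σ² b ≈ b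
    -- In the case σ(b) = -b, both σ²(b) and b have sum 0 with σ(b), the former by additivity of σ.
    σ²b≈b = [ (λ σb≈b → trans (^-congˡ q σb≈b) σb≈b) , (λ σb≈-b → +-cancelʳ (σ b) _ _ (begin
      σ² b + σ b        ≈⟨ +-congʳ (^-congˡ q σb≈-b) ⟩
      σ (- b) + σ b     ≈⟨ ^q-+ (- b) b ⟨
      σ (- b + b)       ≈⟨ ^-congˡ q (-‿inverseˡ b) ⟩
      σ 0#              ≈⟨ σ-0 ⟩
      0#                ≈⟨ -‿inverseʳ b ⟨
      b - b             ≈⟨ +-congˡ σb≈-b ⟨
      b + σ b           ∎)) ]′ σb≈±b

    f : Carrier → Carrier
    f x = b * x ^ q + x ^ (q ℕ.^ 5)

    f-cong : ∀ {x y} → x ≈ y → f x ≈ f y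
    f-cong x≈y = +-cong (*-congˡ (^-congˡ q x≈y)) (^-congˡ (q ℕ.^ 5) x≈y)

    f-+ : ∀ x y → f (x + y) ≈ f x + f y
    f-+ x y = begin
      b * (x + y) ^ q + (x + y) ^ (q ℕ.^ 5)
        ≈⟨ +-cong (trans (*-congˡ (^q-+ x y)) (distribˡ b _ _)) (^qⁿ-+ 5 x y) ⟩
      (b * x ^ q + b * y ^ q) + (x ^ (q ℕ.^ 5) + y ^ (q ℕ.^ 5))
        ≈⟨ interchange _ _ _ _ ⟩
      f x + f y ∎
      where open import Algebra.Properties.CommutativeSemigroup (CommutativeMonoid.commutativeSemigroup +-commutativeMonoid) using (interchange)

    f-⟦a⟧* : ∀ a x → f (⟦ a ⟧ * x) ≈ ⟦ a ⟧ * f x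
    f-⟦a⟧* a x = begin
      b * (⟦ a ⟧ * x) ^ q + (⟦ a ⟧ * x) ^ (q ℕ.^ 5)
        ≈⟨ +-cong (*-congˡ (^-distrib-* ⟦ a ⟧ x q)) (^-distrib-* ⟦ a ⟧ x (q ℕ.^ 5)) ⟩
      b * (⟦ a ⟧ ^ q * x ^ q) + ⟦ a ⟧ ^ (q ℕ.^ 5) * x ^ (q ℕ.^ 5)
        ≈⟨ +-cong (*-congˡ (*-congʳ (⟦a⟧^q≈⟦a⟧ a))) (*-congʳ (⟦a⟧^qⁿ≈⟦a⟧ 5 a)) ⟩
      b * (⟦ a ⟧ * x ^ q) + ⟦ a ⟧ * x ^ (q ℕ.^ 5)
        ≈⟨ +-congʳ (x∙yz≈y∙xz b ⟦ a ⟧ _) ⟩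
      ⟦ a ⟧ * (b * x ^ q) + ⟦ a ⟧ * x ^ (q ℕ.^ 5)
        ≈⟨ distribˡ ⟦ a ⟧ _ _ ⟨
      ⟦ a ⟧ * f x ∎
      where open import Algebra.Properties.CommutativeSemigroup *-commutativeSemigroup using (x∙yz≈y∙xz)

    f-0 : f 0# ≈ 0#
    f-0 = +-cancelʳ (f 0#) _ _ (trans (sym (f-+ 0# 0#)) (trans (f-cong (+-identityʳ 0#)) (sym (+-identityˡ _))))

    f-semilinear⇒∈K : ∀ {x l} → x ≉ 0# → f (l * x) ≈ l * f x → ∃[ a ] l ≈ ⟦ a ⟧
    f-semilinear⇒∈K {x} {l} x≉0 eq = x^q≈x⇒x∈K (proportional⇒fixed σ⁸ b≉0 b²+1≈0 σ²b≈b x≉0 (begin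
      b * σ (l * x) + σ⁵ (l * x)   ≈⟨ +-congˡ (x^qⁿ≈σⁿx 5 (l * x)) ⟨
      f (l * x)                    ≈⟨ eq ⟩
      l * f x                      ≈⟨ *-congˡ (+-congˡ (x^qⁿ≈σⁿx 5 x)) ⟩
      l * (b * σ x + σ⁵ x)         ∎))

    U : Pred Carrierᴹ _
    U = U[_,1] q K L φ b

    graph : Carrier → Carrierᴹ
    graph x = x , f x

    graph-cong : ∀ {x y} → x ≈ y → graph x ≈ᴹ graph y
    graph-cong x≈y = x≈y , f-cong x≈y

    U-isSubspace : IsSubspace L²∣K U
    U-isSubspace = record
      { respects  = λ u≈v (x , u≈) → x , V.≈ᴹ-trans (V.≈ᴹ-sym u≈v) u≈
      ; 0ᴹ-closed = 0# , refl , sym f-0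
      ; +ᴹ-closed = λ (x , u≈) (y , v≈) → x + y , V.≈ᴹ-trans (V.+ᴹ-cong u≈ v≈) (refl , sym (f-+ x y))
      ; *ₗ-closed = λ a (x , u≈) → ⟦ a ⟧ * x , V.≈ᴹ-trans (V.*ₗ-congˡ u≈) (refl , sym (f-⟦a⟧* a x))
      }

    _≟ᴹ_ : ∀ u v → Dec (u ≈ᴹ v)
    (x , y) ≟ᴹ (x′ , y′) = (x ≟ x′) ×-dec (y ≟ y′)

    U-scattered : IsScattered U
    U-scattered = record { isSubspace = U-isSubspace ; dim≤1 = dim≤1 }
      where
      -- The dimension has to be named, so a finite search looks for a nonzero x with `graph x` on
      -- the line: failure means dimension 0, and success makes `graph x` a basis.
      dim≤1 : ∀ v → v ≉ᴹ 0ᴹ → ∃[ d ] HasDimension L²∣K (⟨ L² ⟩ v ∩ U) d × d ℕ.≤ 1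
      dim≤1 v@(v₁ , v₂) v≉0
        with ∃? (λ x≈y (x≉0 , a , eq) → x≉0 ∘ trans x≈y , a , V.≈ᴹ-trans (V.≈ᴹ-sym (graph-cong x≈y)) eq)
                (λ x → ¬? (x ≟ 0#) ×-dec ∃? (λ a≈c eq → V.≈ᴹ-trans eq (*-congʳ a≈c , *-congʳ a≈c)) (λ a → graph x ≟ᴹ (a * v₁ , a * v₂)))
      ... | no ∄ = 0 , ((λ ()) , record
        { members     = λ ()
        ; independent = λ _ _ ()
        ; spanning    = λ {u} (u∈⟨v⟩@(a , u≈av) , x , u≈x) → (λ ()) , zero-vector u≈av u≈x
        }) , ℕ.z≤n
        where
        zero-vector : ∀ {u a x} → u ≈ᴹ (a * v₁ , a * v₂) → u ≈ᴹ graph x → u ≈ᴹ 0ᴹ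
        zero-vector {u} {a} {x} u≈av u≈x with x ≟ 0#
        ... | yes x≈0 = V.≈ᴹ-trans u≈x (V.≈ᴹ-trans (graph-cong x≈0) (refl , f-0))
        ... | no  x≉0 = contradiction (x , x≉0 , a , V.≈ᴹ-trans (V.≈ᴹ-sym u≈x) u≈av) ∄
      ... | yes (x , x≉0 , a , (x≈av₁ , fx≈av₂)) = 1 , ((λ _ → graph x) , record
        { members     = λ _ → (a , x≈av₁ , fx≈av₂) , x , refl , refl
        ; independent = λ k eq → λ { zero → ⟦a⟧≈0⇒a≈0 (k₀≈0 (trans (sym (+-identityʳ _)) (proj₁ eq))) }
        ; spanning    = λ ((c , u≈cv) , y , u≈y) → multiple u≈cv u≈y
        }) , ℕ.≤-refl
        where
        k₀≈0 : ∀ {k} → k * x ≈ 0# → k ≈ 0#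
        k₀≈0 kx≈0 = [ id , (λ x≈0 → contradiction x≈0 x≉0) ]′ (xy≈0⇒x≈0∨y≈0 kx≈0)
        a≉0 : a ≉ 0#
        a≉0 a≈0 = x≉0 (trans x≈av₁ (trans (*-congʳ a≈0) (zeroˡ v₁)))
        a⁻¹ = proj₁ (inverse a≉0)
        -- The generator `v` of the line need not belong to U; this trades a multiple of `v` for a
        -- multiple of `graph x`.
        rescale : ∀ {c z w} → z ≈ a * w → c * w ≈ (c * a⁻¹) * z
        rescale {c} {z} {w} z≈aw = begin
          c * w                   ≈⟨ *-congʳ (trans (*-congˡ (proj₂ (inverse a≉0))) (*-identityʳ c)) ⟨
          (c * (a⁻¹ * a)) * w     ≈⟨ *-congʳ (*-assoc c a⁻¹ a) ⟨
          ((c * a⁻¹) * a) * w     ≈⟨ *-assoc (c * a⁻¹) a w ⟩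
          (c * a⁻¹) * (a * w)     ≈⟨ *-congˡ z≈aw ⟨
          (c * a⁻¹) * z           ∎
        -- With l = c a⁻¹, comparing u = l·(x, f(x)) with u = (y, f(y)) gives y = lx and f(lx) = l
        -- f(x), so l comes from K.
        multiple : ∀ {u c y} → u ≈ᴹ (c * v₁ , c * v₂) → u ≈ᴹ graph y →
                   ∃[ k ] u ≈ᴹ linearCombination L²∣K k (λ (_ : Fin 1) → graph x)
        multiple {u} {c} {y} (u₁≈cv₁ , u₂≈cv₂) (u₁≈y , u₂≈fy) =
          let k , l≈⟦k⟧ = f-semilinear⇒∈K x≉0 (begin
                f (l * x)  ≈⟨ f-cong (trans (sym u₁≈lx) u₁≈y) ⟩
                f y        ≈⟨ u₂≈fy ⟨
                proj₂ u    ≈⟨ u₂≈lfx ⟩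
                l * f x    ∎)
          in (λ _ → k) , V.≈ᴹ-trans
               (trans u₁≈lx (*-congʳ l≈⟦k⟧) , trans u₂≈lfx (*-congʳ l≈⟦k⟧)) (V.≈ᴹ-sym (V.+ᴹ-identityʳ _))
          where
          l = c * a⁻¹
          u₁≈lx : proj₁ u ≈ l * x
          u₁≈lx = trans u₁≈cv₁ (rescale x≈av₁)
          u₂≈lfx : proj₂ u ≈ l * f x
          u₂≈lfx = trans u₂≈cv₂ (rescale fx≈av₂)

    points : Fin (q ℕ.^ 8) → Carrierᴹ
    points = graph ∘ elem

    points∈U : ∀ i → points i ∈ U
    points∈U i = elem i , refl , refl

    U⊆points : ∀ {u} → u ∈ U → ∃[ i ] u ≈ᴹ points i
    U⊆points (x , u≈x) = index x , V.≈ᴹ-trans u≈x (graph-cong (sym (elem-index x)))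

    points-injective : ∀ {i j} → points i ≈ᴹ points j → i ≡ j
    points-injective {i} {j} (eᵢ≈eⱼ , _) =
      ≡.trans (≡.sym (index-elem i)) (≡.trans (index-cong eᵢ≈eⱼ) (index-elem j))

    U-hasDimension : ∃[ n ] HasDimension L²∣K U n
    U-hasDimension = LA.hasDimension U-isSubspace points U⊆points points∈U _≟ᴹ_

    -- The search returns some dimension n; the q⁸ distinct points of the graph force q⁸ ≤ q^n. The
    -- bound on scattered subspaces then needs only this inequality.
    8≤dimU : 8 ℕ.≤ proj₁ U-hasDimension
    8≤dimU = ℕ.≮⇒≥ λ n<8 → ℕ.<⇒≱ (ℕ.^-monoʳ-< q LA.1<q n<8)
      (LA.spanning⇒N≤q^n U-isSubspace points U⊆points points∈U points-injective (proj₂ (proj₂ U-hasDimension)))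

    U-maximumScattered : ∀ {w} → IsMaximumScattered w U
    U-maximumScattered = record
      { isScattered  = U-scattered
      ; dim          = proj₁ U-hasDimension
      ; hasDimension = proj₂ U-hasDimension
      ; maximum      = λ W W-scattered d W-dim → ℕ.≤-trans
          -- Two distinct indices below m express m ≥ 2. For m = 1 the bound fails, since the whole
          -- plane is then scattered of dimension 2.
          (ScatteredBound.scattered⇒dim≤m q 8 K L φ W-scattered {zero} {suc zero} (λ ()) W-dim) 8≤dimU
      }

theorem7p2 :
  ∀ {c₁ ℓ₁ a₁ c₂ ℓ₂ a₂ w : Level} (q : ℕ) → IsPrimePower q → 2 ∤ q →
  (K : FiniteField c₁ ℓ₁ a₁ q) (L : FiniteField c₂ ℓ₂ a₂ (q ℕ.^ 8))
  (φ : RingHomomorphism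
         (CommutativeRing.rawRing (FiniteField.commutativeRing K))
         (CommutativeRing.rawRing (FiniteField.commutativeRing L))) →
  let open FieldExtension q 8 K L φ in
  (b : Carrier) → b ≉ 0# → b ^ 2 ≈ - 1# →
  IsMaximumScattered w (U[_,1] q K L φ b)
theorem7p2 q q-primePower 2∤q K L φ b b≉0 b²≈-1 =
  BinomialSubspace.U-maximumScattered q q-primePower 2∤q K L φ b b≉0 b²≈-1
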